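{- For all integers $n\geq 0$, $c_{5}(n)\equiv 1 \pmod 2$ if $n=(7j^{2}+j)/2$ for some $j\in\mathbb{Z}$, and $c_{5}(n)\equiv 0 \pmod 2$ otherwise.
   Context: A partition of $n$ is a finite non-increasing sequence of positive integers (its parts) summing to $n$. Let $c_{5}(n)$ be the number of partitions of $n$ in which either (a) all parts are even and distinct, or (b) the odd parts are gap-free, i.e. they are exactly $1,3,\ldots,2k-1$ for some $k\geq1$, each appearing two or three times, the even parts are distinct, and the smallest even part is at least $2(2k-1)+4$ (twice the largest odd part plus $4$). -}

module Defs where

open import Data.Nat using (ℕ; zero; suc; _+_; _*_; _∸_; _⊔_; _≤ᵇ_; _≡ᵇ_; _/_)
open import Data.Nat.Base using (_%_)
open import Data.Bool using (Bool; true; false; _∧_; _∨_; not; if_then_else_)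
open import Data.List using (List; []; _∷_; map; concatMap; length; foldr; upTo; applyUpTo; filterᵇ)
open import Data.Bool.ListAction using (all; any)
open import Data.Nat.ListAction using (sum)

isEven : ℕ → Bool
isEven n = (n % 2) ≡ᵇ 0

isOdd : ℕ → Bool
isOdd n = not (isEven n)

count : ℕ → List ℕ → ℕ
count x = foldr (λ y c → if y ≡ᵇ x then suc c else c) 0

distinctᵇ : List ℕ → Bool
distinctᵇ [] = true
distinctᵇ (x ∷ xs) = not (any (λ y → y ≡ᵇ x) xs) ∧ distinctᵇ xs

nonIncᵇ : List ℕ → Bool
nonIncᵇ [] = true
nonIncᵇ (x ∷ []) = true
nonIncᵇ (x ∷ y ∷ xs) = (y ≤ᵇ x) ∧ nonIncᵇ (y ∷ xs)

isPartitionᵇ : ℕ → List ℕ → Bool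
isPartitionᵇ n p = nonIncᵇ p ∧ all (λ x → 1 ≤ᵇ x) p ∧ (sum p ≡ᵇ n)

listsOf : ℕ → ℕ → List (List ℕ)
listsOf n zero = [] ∷ []
listsOf n (suc k) = concatMap (λ x → map (x ∷_) (listsOf n k)) (applyUpTo suc n)

-- all partitions of n (every partition of n has at most n parts, each in {1,…,n}),
-- listed without repetition
partitions : ℕ → List (List ℕ)
partitions n = filterᵇ (isPartitionᵇ n) (concatMap (listsOf n) (upTo (suc n)))

condAᵇ : List ℕ → Bool
condAᵇ p = all isEven p ∧ distinctᵇ p

-- condition (b): odd parts are exactly 1,3,…,2k-1 (k ≥ 1), each appearing 2 or 3 times;
-- even parts distinct; smallest even part ≥ 2(2k-1)+4.
condBᵇ : List ℕ → Bool
condBᵇ p =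
  let odds  = filterᵇ isOdd p
      evens = filterᵇ isEven p
      m     = foldr _⊔_ 0 odds          -- largest odd part = 2k-1
      k     = (m + 1) / 2
  in  (1 ≤ᵇ length odds)
    ∧ all (λ i → let c = count (2 * i ∸ 1) p in (2 ≤ᵇ c) ∧ (c ≤ᵇ 3)) (applyUpTo suc k)
    ∧ distinctᵇ evens
    ∧ all (λ e → (2 * m + 4) ≤ᵇ e) evens

c5 : ℕ → ℕ
c5 n = length (filterᵇ (λ p → condAᵇ p ∨ condBᵇ p) (partitions n))

{-# OPTIONS --safe #-}

-- Let Q = q². Over 𝔽₂ the generating function of c₅ is
--   Σₖ Q^{k²} (1+q)(1+q³)⋯(1+q^{2k−1}) ∏_{i>2k} (1+Qⁱ),
-- where 2k − 1 is the largest odd part (k = 0 in case (a)). The Bailey pair identity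
--   (1+q)(1+q³)⋯(1+q^{2k−1}) = Σ_{r∈ℤ} q^{r(3r+1)/2} [2k choose k+r]_Q
-- and the q-Vandermonde (Durfee rectangle) sum
--   Σₖ Q^{k²} [2k choose k+r]_Q ∏_{i>2k} (1+Qⁱ) = Q^{r²}
-- turn it into Σ_{r∈ℤ} q^{(7r²+r)/2}: this is the Rogers–Selberg identity modulo 2. Both identities
-- follow by induction from the two Pascal rules, the first because equal terms cancel in pairs.

module Submission where

-- Why the sum is that of Rogers and Selberg: modulo 2 squaring is additive, so (Q;Q)_{2k} becomes
-- the square of (q;q)_{2k} = (q;q²)_k (Q;Q)_k. Hence (q;q²)_k / (Q;Q)_{2k} agrees with 1 /
-- ((q;q²)_k (Q;Q)_k²), which is also the reduction of 1 / ((Q;Q)_k (-q;q)_{2k}). No quotient and no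
-- infinite product is formed. Gaussian binomials come from Pascal's rules, denominators are
-- cleared, the product over i > 2k stops at i = 2n for every k, and equality is taken modulo q^K
-- with K ≤ n. Factors gained or lost by the cut-off then act as 1 next to Q^{k²} or Q^{r²}. Sums
-- over r ∈ ℤ are folded onto r ≥ 0. The binomials are even in r but the weights q^{r(3r+1)/2} are
-- not, so each positive index carries the two weights `u` and `v`, and the ends of the folded sums
-- need separate care. On the combinatorial side the admissible partitions are listed explicitly,
-- and the list of their sums, read as a list of exponents, is itself the generating polynomial.

module RogersSelberg where

  open import Algebra.Bundles using (CommutativeSemiring; RawRing)
  open import Algebra.Solver.Ring.AlmostCommutativeRing
    using (_-Raw-AlmostCommutative⟶_; fromCommutativeSemiring)
  open import Data.Bool using (Bool; true; false; _xor_; _∧_)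
  open import Data.Bool.Properties using () renaming (_≟_ to _≟ᵇ_)
  open import Data.Maybe using (Maybe; just; nothing)
  open import Data.Nat using (ℕ; zero; suc; _≤_; _<_; z≤n; s≤s; _∸_; _≤?_)
  import Data.Nat as ℕ
  open import Data.Nat.Properties
    using (≤-refl; ≤-trans; ≰⇒>; m≤n⇒m≤1+n; n≤1+n; m+[n∸m]≡n; m+n∸m≡n; +-suc; [m+n]∸[m+o]≡n∸o; m≤m+n; m≤n+m; +-monoʳ-≤; +-mono-≤; <⇒≤; m∸n+n≡m)
    renaming (+-identityʳ to n+0≡n)
  import Data.Nat.Properties as ℕₚ
  open import Data.Nat.Tactic.RingSolver using (solve-∀)
  open import Relation.Binary.PropositionalEquality as ≡ using (_≡_)
  open import Level using (_⊔_)
  open import Relation.Nullary using (Dec; yes; no)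

  -- The exponents (7j² + j)/2 for j = r + 1 and j = −(r + 1), and τ r = 3r(r + 1)/2.
  τ exponent⁺ exponent⁻ : ℕ → ℕ
  τ zero    = 0
  τ (suc r) = τ r ℕ.+ 3 ℕ.* suc r
  exponent⁺ r = τ r ℕ.+ 2 ℕ.* suc r ℕ.+ 2 ℕ.* (suc r ℕ.* suc r)
  exponent⁻ r = τ r ℕ.+ suc r ℕ.+ 2 ℕ.* (suc r ℕ.* suc r)

  -- A ring of characteristic 2 with the powers of an element q.
  record Monomials {α ℓ} (R : CommutativeSemiring α ℓ) : Set (α ⊔ ℓ) where
    open CommutativeSemiring R
    field
      1+1≈0 : 1# + 1# ≈ 0#
      q^_   : ℕ → Carrier
      q^0≈1 : q^ 0 ≈ 1#
      q^-+  : ∀ i j → q^ (i ℕ.+ j) ≈ q^ i * q^ j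

  -- Arithmetic in characteristic 2 and finite sums.

  module QSeries {α ℓ} (R : CommutativeSemiring α ℓ) (monomials : Monomials R) where

    open CommutativeSemiring R hiding (zero)
    open Monomials monomials
    open import Relation.Binary.Reasoning.Setoid setoid

    -- The ring solver with coefficients in 𝔽₂, so that x + x is normalised to 0.
    𝔽₂ : RawRing _ _
    𝔽₂ = record { Carrier = Bool ; _≈_ = _≡_ ; _+_ = _xor_ ; _*_ = _∧_ ; -_ = λ b → b
                ; 0# = false ; 1# = true }

    ⟦_⟧₂ : Bool → Carrier
    ⟦ false ⟧₂ = 0#
    ⟦ true  ⟧₂ = 1#

    𝔽₂⟶R : 𝔽₂ -Raw-AlmostCommutative⟶ fromCommutativeSemiring R
    𝔽₂⟶R = record
      { ⟦_⟧    = ⟦_⟧₂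
      ; +-homo = λ { false b → sym (+-identityˡ _) ; true false → sym (+-identityʳ _)
                   ; true true → sym 1+1≈0 }
      ; *-homo = λ { false b → sym (zeroˡ _) ; true b → sym (*-identityˡ _) }
      ; -‿homo = λ _ → refl
      ; 0-homo = refl
      ; 1-homo = refl
      }

    coeff≟ : ∀ x y → Maybe (⟦ x ⟧₂ ≈ ⟦ y ⟧₂)
    coeff≟ x y with x ≟ᵇ y
    ... | yes eq = just (reflexive (≡.cong ⟦_⟧₂ eq))
    ... | no  _  = nothing

    open import Algebra.Solver.Ring 𝔽₂ (fromCommutativeSemiring R) 𝔽₂⟶R coeff≟
      using (solve; _:+_; _:*_; _:=_; con)

    q^-merge : ∀ {i j k} → i ℕ.+ j ≡ k → q^ i * q^ j ≈ q^ k
    q^-merge {i} {j} eq = trans (sym (q^-+ i j)) (reflexive (≡.cong q^_ eq))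

    Q : ℕ → Carrier
    Q k = q^ (2 ℕ.* k)

    Q-merge : ∀ i j {k} → i ℕ.+ j ≡ k → Q i * Q j ≈ Q k
    Q-merge i j ≡.refl = q^-merge (lem i j)
      where
      lem : ∀ i j → 2 ℕ.* i ℕ.+ 2 ℕ.* j ≡ 2 ℕ.* (i ℕ.+ j)
      lem = solve-∀

    ∑ : ℕ → (ℕ → Carrier) → Carrier
    ∑ zero    f = 0#
    ∑ (suc n) f = f 0 + ∑ n (λ i → f (suc i))

    ∑-cong< : ∀ n {f g : ℕ → Carrier} → (∀ i → i < n → f i ≈ g i) → ∑ n f ≈ ∑ n g
    ∑-cong< zero    h = refl
    ∑-cong< (suc n) h = +-cong (h 0 (s≤s z≤n)) (∑-cong< n (λ i i<n → h (suc i) (s≤s i<n)))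

    ∑-cong : ∀ n {f g : ℕ → Carrier} → (∀ i → f i ≈ g i) → ∑ n f ≈ ∑ n g
    ∑-cong n h = ∑-cong< n (λ i _ → h i)

    ∑-+ : ∀ n (f g : ℕ → Carrier) → ∑ n (λ i → f i + g i) ≈ ∑ n f + ∑ n g
    ∑-+ zero    f g = sym (+-identityˡ _)
    ∑-+ (suc n) f g = trans (+-congˡ (∑-+ n _ _))
      (solve 4 (λ x y z w → (x :+ y) :+ (z :+ w) := (x :+ z) :+ (y :+ w)) refl _ _ _ _)

    ∑-* : ∀ n x (f : ℕ → Carrier) → ∑ n (λ i → x * f i) ≈ x * ∑ n f
    ∑-* zero    x f = sym (zeroʳ _)
    ∑-* (suc n) x f = trans (+-congˡ (∑-* n x _)) (sym (distribˡ _ _ _))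

    ∑-0 : ∀ n → ∑ n (λ _ → 0#) ≈ 0#
    ∑-0 zero    = refl
    ∑-0 (suc n) = trans (+-identityˡ _) (∑-0 n)

    ∑-swap : ∀ m n (f : ℕ → ℕ → Carrier) → ∑ m (λ i → ∑ n (f i)) ≈ ∑ n (λ j → ∑ m (λ i → f i j))
    ∑-swap zero    n f = sym (∑-0 n)
    ∑-swap (suc m) n f = trans (+-congˡ (∑-swap m n _)) (sym (∑-+ n _ _))

    ∑-last : ∀ n (f : ℕ → Carrier) → ∑ (suc n) f ≈ ∑ n f + f n
    ∑-last zero    f = +-comm _ _
    ∑-last (suc n) f = trans (+-congˡ (∑-last n _)) (sym (+-assoc _ _ _))

    ∑-shift : ∀ n (f : ℕ → Carrier) → f n ≈ 0# → f 0 + ∑ n (λ i → f (suc i)) ≈ ∑ n f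
    ∑-shift n f fn≈0 = trans (∑-last n f) (trans (+-congˡ fn≈0) (+-identityʳ _))

    ∑-drop : ∀ m n (f : ℕ → Carrier) → (∀ i → i < m → f i ≈ 0#) →
             ∑ (m ℕ.+ n) f ≈ ∑ n (λ i → f (m ℕ.+ i))
    ∑-drop zero    n f h = refl
    ∑-drop (suc m) n f h = trans (+-cong (h 0 (s≤s z≤n)) (∑-drop m n _ (λ i i<m → h (suc i) (s≤s i<m))))
                                 (+-identityˡ _)

    -- Gaussian binomials in base q², from Pascal's rules alone.

    -- The Gaussian binomial coefficient [N choose k] in base Q = q².
    G : ℕ → ℕ → Carrier
    G _       zero    = 1#
    G zero    (suc k) = 0#
    G (suc N) (suc k) = G N k + Q (suc k) * G N (suc k)

    G-zero : ∀ {N k} → N < k → G N k ≈ 0#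
    G-zero {zero}  {suc k} _         = refl
    G-zero {suc N} {suc k} (s≤s N<k) = begin
      G N k + Q (suc k) * G N (suc k) ≈⟨ +-cong (G-zero N<k) (*-congˡ (G-zero (m≤n⇒m≤1+n N<k))) ⟩
      0# + Q (suc k) * 0#             ≈⟨ trans (+-identityˡ _) (zeroʳ _) ⟩
      0#                              ∎

    -- Exponents such as `N ∸ k` are wrong once the subtraction truncates, but then the binomial
    -- vanishes. It is therefore enough to compare exponents for k ≤ N.
    Q*G-cong : ∀ {x y N k} → (k ≤ N → x ≡ y) → Q x * G N k ≈ Q y * G N k
    Q*G-cong {x} {y} {N} {k} h with k ≤? N
    ... | yes k≤N = *-congʳ (reflexive (≡.cong Q (h k≤N)))
    ... | no  k≰N = trans (vanish x) (sym (vanish y))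
      where
      vanish : ∀ x → Q x * G N k ≈ 0#
      vanish x = trans (*-congˡ (G-zero (≰⇒> k≰N))) (zeroʳ _)

    -- `G` is defined by one Pascal rule and this is the other. In the inductive step both entries
    -- are expanded by this rule and regrouped by the defining one; the middle coefficients agree
    -- because both have exponent N + 1.
    G-pascal : ∀ N k → G (suc N) (suc k) ≈ Q (N ∸ k) * G N k + G N (suc k)
    G-pascal zero    zero    = trans (+-congˡ (zeroʳ _))
      (+-congʳ (sym (trans (*-identityʳ _) q^0≈1)))
    G-pascal zero    (suc k) = trans (+-congˡ (zeroʳ _))
      (+-congʳ (sym (zeroʳ _)))
    G-pascal (suc N) zero    = begin
      1# + Q 1 * G (suc N) 1                  ≈⟨ +-congˡ (*-congˡ (G-pascal N 0)) ⟩
      1# + Q 1 * (Q N * 1# + G N 1)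
        ≈⟨ solve 3 (λ x y z → con true :+ x :* (y :* con true :+ z) := x :* y :+ (con true :+ x :* z)) refl _ _ _ ⟩
      Q 1 * Q N + (1# + Q 1 * G N 1)          ≈⟨ +-congʳ (trans (Q-merge 1 N ≡.refl) (sym (*-identityʳ _))) ⟩
      Q (suc N) * 1# + G (suc N) 1            ∎
    G-pascal (suc N) (suc k) = begin
      G (suc N) (suc k) + Q (2 ℕ.+ k) * G (suc N) (2 ℕ.+ k)
        ≈⟨ +-cong (G-pascal N k) (*-congˡ (G-pascal N (suc k))) ⟩
      (Q (N ∸ k) * G N k + G N (suc k)) + Q (2 ℕ.+ k) * (Q (N ∸ suc k) * G N (suc k) + G N (2 ℕ.+ k))
        ≈⟨ solve 6 (λ x a b y z c → (x :* a :+ b) :+ y :* (z :* b :+ c) := (x :* a :+ (y :* z) :* b) :+ (b :+ y :* c)) refl _ _ _ _ _ _ ⟩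
      (Q (N ∸ k) * G N k + (Q (2 ℕ.+ k) * Q (N ∸ suc k)) * G N (suc k)) + G (suc N) (2 ℕ.+ k)
        ≈⟨ +-congʳ (+-congˡ (trans (*-congʳ (Q-merge (2 ℕ.+ k) (N ∸ suc k) ≡.refl)) (Q*G-cong {k = suc k} exps))) ⟩
      (Q (N ∸ k) * G N k + Q (N ∸ k ℕ.+ suc k) * G N (suc k)) + G (suc N) (2 ℕ.+ k)
        ≈⟨ +-congʳ (+-congˡ (*-congʳ (sym (Q-merge (N ∸ k) (suc k) ≡.refl)))) ⟩
      (Q (N ∸ k) * G N k + (Q (N ∸ k) * Q (suc k)) * G N (suc k)) + G (suc N) (2 ℕ.+ k)
        ≈⟨ +-congʳ (solve 4 (λ x a y b → x :* a :+ (x :* y) :* b := x :* (a :+ y :* b)) refl _ _ _ _) ⟩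
      Q (N ∸ k) * G (suc N) (suc k) + G (suc N) (2 ℕ.+ k) ∎
      where
      exps : suc k ≤ N → 2 ℕ.+ k ℕ.+ (N ∸ suc k) ≡ N ∸ k ℕ.+ suc k
      exps k<N = ≡.trans (≡.cong suc (m+[n∸m]≡n k<N))
        (≡.sym (≡.trans (+-suc (N ∸ k) k) (≡.cong suc (m∸n+n≡m (<⇒≤ k<N)))))

    G-sym : ∀ i j → G (i ℕ.+ j) i ≈ G (i ℕ.+ j) j
    G-sym zero    zero    = refl
    G-sym zero    (suc j) = begin
      1#                          ≈⟨ trans (sym (+-identityʳ _)) (+-cong (G-sym 0 j) (sym (zeroʳ _))) ⟩
      G j j + Q (suc j) * 0#      ≈⟨ +-congˡ (*-congˡ (sym (G-zero {j} ≤-refl))) ⟩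
      G (suc j) (suc j)           ∎
    G-sym (suc i) zero    = begin
      G (i ℕ.+ 0) i + Q (suc i) * G (i ℕ.+ 0) (suc i)
        ≈⟨ +-cong (G-sym i 0) (trans (*-congˡ (G-zero (≡.subst (_< suc i) (≡.sym (n+0≡n i)) ≤-refl))) (zeroʳ _)) ⟩
      1# + 0# ≈⟨ +-identityʳ _ ⟩
      1# ∎
    G-sym (suc i) (suc j) = begin
      G N i + Q (suc i) * G N (suc i)
        ≈⟨ +-cong (G-sym i (suc j)) (*-congˡ step) ⟩
      G N (suc j) + Q (suc i) * G N j   ≈⟨ +-comm _ _ ⟩
      Q (suc i) * G N j + G N (suc j)
        ≈⟨ +-congʳ (*-congʳ (reflexive (≡.cong Q (≡.sym (≡.trans (≡.cong (_∸ j) (≡.trans (+-suc i j) (lem i j))) (m+n∸m≡n j (suc i))))))) ⟩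
      Q (N ∸ j) * G N j + G N (suc j)   ≈⟨ G-pascal N j ⟨
      G (suc N) (suc j) ∎
      where
      N = i ℕ.+ suc j
      lem : ∀ i j → suc (i ℕ.+ j) ≡ j ℕ.+ suc i
      lem = solve-∀
      step : G N (suc i) ≈ G N j
      step rewrite +-suc i j = G-sym (suc i) j

    -- Add one Pascal rule to Q^{k+1} times the other: [N choose k+1] appears twice with the same
    -- coefficient and cancels. This replaces the quotient formula for the binomial.
    G-absorb : ∀ {N k} → k ≤ N → G (suc N) (suc k) * (1# + Q (suc k)) ≈ (1# + Q (suc N)) * G N k
    G-absorb {N} {k} k≤N = begin
      G (suc N) (suc k) * (1# + Q (suc k))
        ≈⟨ trans (distribˡ _ _ _) (+-cong (*-identityʳ _) (*-congʳ (G-pascal N k))) ⟩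
      (G N k + Q (suc k) * G N (suc k)) + (Q (N ∸ k) * G N k + G N (suc k)) * Q (suc k)
        ≈⟨ solve 4 (λ a y b z → (a :+ y :* b) :+ (z :* a :+ b) :* y := (con true :+ z :* y) :* a) refl _ _ _ _ ⟩
      (1# + Q (N ∸ k) * Q (suc k)) * G N k
        ≈⟨ *-congʳ (+-congˡ (Q-merge (N ∸ k) (suc k) (≡.trans (+-suc (N ∸ k) k) (≡.cong suc (m∸n+n≡m k≤N))))) ⟩
      (1# + Q (suc N)) * G N k ∎

    G-two-steps : ∀ N k → G (2 ℕ.+ N) (2 ℕ.+ k) ≈
      (1# + Q (suc N)) * G N (suc k) + (Q (2 ℕ.+ k) * G N (2 ℕ.+ k) + Q (N ∸ k) * G N k)
    G-two-steps N k = begin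
      G (suc N) (suc k) + Q (2 ℕ.+ k) * G (suc N) (2 ℕ.+ k)
        ≈⟨ +-cong (G-pascal N k) (*-congˡ (G-pascal N (suc k))) ⟩
      (Q (N ∸ k) * G N k + G N (suc k)) + Q (2 ℕ.+ k) * (Q (N ∸ suc k) * G N (suc k) + G N (2 ℕ.+ k))
        ≈⟨ solve 6 (λ x a b y z c → (x :* a :+ b) :+ y :* (z :* b :+ c) := (b :+ (y :* z) :* b) :+ (y :* c :+ x :* a)) refl _ _ _ _ _ _ ⟩
      (G N (suc k) + (Q (2 ℕ.+ k) * Q (N ∸ suc k)) * G N (suc k)) + _
        ≈⟨ +-congʳ (+-congˡ (trans (*-congʳ (Q-merge (2 ℕ.+ k) (N ∸ suc k) ≡.refl)) (Q*G-cong {k = suc k} (λ k<N → ≡.cong suc (m+[n∸m]≡n k<N))))) ⟩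
      (G N (suc k) + Q (suc N) * G N (suc k)) + _
        ≈⟨ +-congʳ (solve 2 (λ b y → b :+ y :* b := (con true :+ y) :* b) refl _ _) ⟩
      (1# + Q (suc N)) * G N (suc k) + _ ∎

    -- The binomial at distance r from the centre of row 2n; it is even in r, so r ≥ 0 suffices.
    c : ℕ → ℕ → Carrier
    c n r = G (n ℕ.+ n) (n ℕ.+ r)

    c-zero : ∀ {n r} → n < r → c n r ≈ 0#
    c-zero {n} {r} n<r = G-zero (≡.subst (_≤ (n ℕ.+ r)) (+-suc n n) (+-monoʳ-≤ n n<r))

    c-step : ∀ n r → c (suc n) (suc r) ≈
      (1# + Q (suc (n ℕ.+ n))) * c n (suc r) + (Q (2 ℕ.+ (n ℕ.+ r)) * c n (2 ℕ.+ r) + Q (n ∸ r) * c n r)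
    c-step n r rewrite +-suc n n | +-suc n (suc r) | +-suc n r
      = trans (G-two-steps (n ℕ.+ n) (n ℕ.+ r))
          (+-congˡ (+-congˡ (*-congʳ (reflexive (≡.cong Q ([m+n]∸[m+o]≡n∸o n n r))))))

    c-pascal : ∀ n r → Q (n ∸ r) * c n r + c n (suc r) ≈ c n r + Q (suc (n ℕ.+ r)) * c n (suc r)
    c-pascal n r rewrite +-suc n r =
      trans (+-congʳ (*-congʳ (reflexive (≡.cong Q (≡.sym ([m+n]∸[m+o]≡n∸o n n r))))))
            (sym (G-pascal (n ℕ.+ n) (n ℕ.+ r)))

    -- `c-step` at the centre would need a negative index. Instead, symmetry makes the two entries
    -- of row 2n + 1 equal; expanding one copy by each Pascal rule produces [2n choose n+1] twice
    -- with coefficient Q^{n+1}, and the pair cancels.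
    c-centre : ∀ n → c (suc n) 0 ≈ (1# + Q (suc (n ℕ.+ n))) * c n 0
    c-centre n = begin
      G (n ℕ.+ suc n) (n ℕ.+ 0) + Q (suc (n ℕ.+ 0)) * G (n ℕ.+ suc n) (suc (n ℕ.+ 0))
        ≡⟨ ≡.cong (λ z → G (n ℕ.+ suc n) z + Q (suc z) * G (n ℕ.+ suc n) (suc z)) (n+0≡n n) ⟩
      G (n ℕ.+ suc n) n + Q (suc n) * G (n ℕ.+ suc n) (suc n)
        ≈⟨ +-congʳ (G-sym n (suc n)) ⟩
      G (n ℕ.+ suc n) (suc n) + Q (suc n) * G (n ℕ.+ suc n) (suc n)
        ≡⟨ ≡.cong (λ z → G z (suc n) + Q (suc n) * G z (suc n)) (+-suc n n) ⟩
      G (suc (n ℕ.+ n)) (suc n) + Q (suc n) * G (suc (n ℕ.+ n)) (suc n)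
        ≈⟨ +-congˡ (*-congˡ (G-pascal (n ℕ.+ n) n)) ⟩
      (G (n ℕ.+ n) n + Q (suc n) * b) + Q (suc n) * (Q (n ℕ.+ n ∸ n) * G (n ℕ.+ n) n + b)
        ≈⟨ solve 4 (λ a y b z → (a :+ y :* b) :+ y :* (z :* a :+ b) := (con true :+ y :* z) :* a) refl _ _ _ _ ⟩
      (1# + Q (suc n) * Q (n ℕ.+ n ∸ n)) * G (n ℕ.+ n) n
        ≈⟨ *-cong (+-congˡ (Q-merge (suc n) (n ℕ.+ n ∸ n) (≡.cong (suc n ℕ.+_) (m+n∸m≡n n n)))) (reflexive (≡.cong (G (n ℕ.+ n)) (≡.sym (n+0≡n n)))) ⟩
      (1# + Q (suc (n ℕ.+ n))) * c n 0 ∎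
      where b = G (n ℕ.+ n) (suc n)

    -- The odd product as a theta-weighted sum of binomials.

    u v : ℕ → Carrier
    u r = q^ (τ r ℕ.+ 2 ℕ.* suc r)
    v r = q^ (τ r ℕ.+ suc r)

    -- θ-sum N x is Σ_{r∈ℤ} q^{r(3r+1)/2} x(|r|), cut off at |r| ≤ N: u r and v r belong to r+1 and −(r+1).
    θ-sum : ℕ → (ℕ → Carrier) → Carrier
    θ-sum N x = x 0 + ∑ N (λ r → (u r + v r) * x (suc r))

    -- The exponent of z r is τ r − r.
    z : ℕ → Carrier
    z zero    = 1#
    z (suc r) = u r

    z-merge : ∀ r → z r * q^ r ≈ q^ (τ r)
    z-merge zero    = *-identityˡ _
    z-merge (suc r) = q^-merge (lem (τ r) r)
      where
      lem : ∀ t r → t ℕ.+ 2 ℕ.* suc r ℕ.+ suc r ≡ t ℕ.+ 3 ℕ.* suc r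
      lem = solve-∀

    module _ (n N : ℕ) (n<N : n < N) where

      -- Since r and -1 - r give the same value of 3r(r+1)/2, `∑T₀ + ∑T₁` is the sum over all r ∈ ℤ
      -- of q^{3r(r+1)/2} [2n choose n+r].
      ∑T₀ ∑T₁ ∑u ∑v : Carrier
      ∑T₀ = ∑ N (λ r → q^ τ r * c n r)
      ∑T₁ = ∑ N (λ r → q^ τ r * c n (suc r))
      ∑u  = ∑ N (λ r → u r * c n (suc r))
      ∑v  = ∑ N (λ r → v r * c n (suc r))

      c-tail : ∀ x {k} → N ≤ k → x * c n k ≈ 0#
      c-tail x N≤k = trans (*-congˡ (c-zero (≤-trans n<N N≤k))) (zeroʳ _)

      θ-split : θ-sum N (c n) ≈ c n 0 + (∑u + ∑v)
      θ-split = +-congˡ (trans (∑-cong N (λ r → distribʳ _ _ _)) (∑-+ N _ _))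

      -- The relation `c-pascal` between neighbours trades q^{τ r} for weights divisible by Q^n:
      -- multiplied by Q^{n+r+1} it becomes Q^n `u r`, while q^{τ r} Q^{n-r} gives the central term
      -- at r = 0 and, with r + 1 for r, Q^n `v r`.
      θ-two-sums : ∑T₀ + ∑T₁ ≈ Q n * (c n 0 + (∑u + ∑v))
      θ-two-sums = begin
        ∑T₀ + ∑T₁
          ≈⟨ ∑-+ N _ _ ⟨
        ∑ N (λ r → q^ τ r * c n r + q^ τ r * c n (suc r))
          ≈⟨ ∑-cong N pointwise ⟩
        ∑ N (λ r → q^ τ r * (Q (n ∸ r) * c n r) + Q n * (u r * c n (suc r)))
          ≈⟨ trans (∑-+ N _ _) (+-congˡ (∑-* N _ _)) ⟩
        ∑ N f + Q n * ∑u
          ≈⟨ +-congʳ (∑-shift N f (trans (*-congˡ (c-tail _ ≤-refl)) (zeroʳ _))) ⟨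
        (f 0 + ∑ N (λ r → f (suc r))) + Q n * ∑u
          ≈⟨ +-congʳ (+-cong (trans (*-congʳ q^0≈1) (*-identityˡ _)) (trans (∑-cong N (λ r → f-suc r (suc r ≤? n))) (∑-* N _ _))) ⟩
        (Q n * c n 0 + Q n * ∑v) + Q n * ∑u
          ≈⟨ solve 4 (λ y a b c → (y :* a :+ y :* b) :+ y :* c := y :* (a :+ (c :+ b))) refl _ _ _ _ ⟩
        Q n * (c n 0 + (∑u + ∑v)) ∎
        where
        f : ℕ → Carrier
        f r = q^ τ r * (Q (n ∸ r) * c n r)

        lem₁ : ∀ t n r → t ℕ.+ 2 ℕ.* suc (n ℕ.+ r) ≡ 2 ℕ.* n ℕ.+ (t ℕ.+ 2 ℕ.* suc r)
        lem₁ = solve-∀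

        lem₂ : ∀ t r d → t ℕ.+ 3 ℕ.* suc r ℕ.+ 2 ℕ.* d ≡ 2 ℕ.* (suc r ℕ.+ d) ℕ.+ (t ℕ.+ suc r)
        lem₂ = solve-∀

        pointwise : ∀ r → q^ τ r * c n r + q^ τ r * c n (suc r) ≈ f r + Q n * (u r * c n (suc r))
        pointwise r = begin
          t * x + t * y
            -- The product of t, a and y is inserted twice, so that one side of `c-pascal` can be
            -- recognised.
            ≈⟨ solve 4 (λ t x y a → t :* x :+ t :* y := t :* (x :+ a :* y) :+ t :* y :+ t :* a :* y) refl _ _ _ _ ⟩
          t * (x + Q (suc (n ℕ.+ r)) * y) + t * y + t * Q (suc (n ℕ.+ r)) * y
            ≈⟨ +-cong (+-congʳ (*-congˡ (sym (c-pascal n r)))) (*-congʳ (trans (q^-merge (lem₁ (τ r) n r)) (q^-+ _ _))) ⟩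
          t * (Q (n ∸ r) * x + y) + t * y + Q n * u r * y
            ≈⟨ solve 6 (λ t a x y b d → t :* (a :* x :+ y) :+ t :* y :+ b :* d :* y := t :* (a :* x) :+ b :* (d :* y)) refl _ _ _ _ _ _ ⟩
          f r + Q n * (u r * y) ∎
          where
          t = q^ τ r
          x = c n r
          y = c n (suc r)

        f-suc : ∀ r → Dec (suc r ≤ n) → f (suc r) ≈ Q n * (v r * c n (suc r))
        f-suc r (no r≮n)  = trans (*-congˡ (trans (*-congˡ e) (zeroʳ _)))
          (trans (zeroʳ _) (sym (trans (*-congˡ (trans (*-congˡ e) (zeroʳ _))) (zeroʳ _))))
          where e = c-zero (≰⇒> r≮n)
        f-suc r (yes r<n) = trans (sym (*-assoc _ _ _)) (trans (*-congʳ (trans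
          (q^-merge (≡.trans (lem₂ (τ r) r (n ∸ suc r)) (≡.cong (λ k → 2 ℕ.* k ℕ.+ (τ r ℕ.+ suc r)) (m+[n∸m]≡n r<n))))
          (q^-+ (2 ℕ.* n) _))) (*-assoc _ _ _))

      -- Write Θ for the sum in row 2n and let r run over ℤ; the three-term recurrence splits the
      -- next sum into three. The central part is (1 + Q^{2n+1}) Θ. The upper neighbours, after r →
      -- r - 1, give q^{2n+1} Σ q^{r(3r-1)/2} [2n choose n+r], which is q^{2n+1} Θ by r → -r. The
      -- lower neighbours, after r → r + 1, give Q^{n+1} Σ q^{3r(r+1)/2} [2n choose n+r], which is
      -- Q^{2n+1} Θ by `θ-two-sums`. The two terms Q^{2n+1} Θ cancel.
      θ-step : θ-sum N (c (suc n)) ≈ (1# + q^ suc (2 ℕ.* n)) * θ-sum N (c n)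
      θ-step = begin
        c (suc n) 0 + ∑ N (λ r → (u r + v r) * c (suc n) (suc r))
          ≈⟨ +-cong (c-centre n) (trans (∑-cong N pointwise) sums) ⟩
        A * c₀ + (A * (∑u + ∑v) + (b * S₁ + a * S₂) + (b * ∑T₀ + a * (c₀ + ∑u)))
          ≈⟨ +-congˡ (+-congʳ (+-congˡ (+-cong (*-congˡ S₁≈) (*-congˡ S₂≈)))) ⟩
        A * c₀ + (A * (∑u + ∑v) + (b * (∑T₁ + c₁) + a * (∑v + q^ 1 * c₁)) + (b * ∑T₀ + a * (c₀ + ∑u)))
          ≈⟨ solve 10 (λ A b a q u v t₀ t₁ c₀ c₁ →
               A :* c₀ :+ (A :* (u :+ v) :+ (b :* (t₁ :+ c₁) :+ a :* (v :+ q :* c₁)) :+ (b :* t₀ :+ a :* (c₀ :+ u)))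
               := (A :+ a) :* (c₀ :+ (u :+ v)) :+ b :* (t₀ :+ t₁) :+ (b :+ a :* q) :* c₁) refl A b a (q^ 1) ∑u ∑v ∑T₀ ∑T₁ c₀ c₁ ⟩
        (A + a) * Θ + b * (∑T₀ + ∑T₁) + (b + a * q^ 1) * c₁
          -- Folding leaves boundary terms in `c₁` with coefficients b and a q; these are equal and
          -- cancel in the next step.
          ≈⟨ +-cong (+-congˡ (*-congˡ θ-two-sums)) (*-congʳ (+-congˡ (q^-merge (lem₁ n)))) ⟩
        (A + a) * Θ + b * (Q n * Θ) + (b + b) * c₁
          ≈⟨ solve 6 (λ d a b e t c₁ → (con true :+ d :+ a) :* t :+ b :* (e :* t) :+ (b :+ b) :* c₁
               := (con true :+ d :+ a :+ b :* e) :* t) refl (Q (suc (n ℕ.+ n))) a b (Q n) Θ c₁ ⟩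
        (1# + Q (suc (n ℕ.+ n)) + a + b * Q n) * Θ
          ≈⟨ *-congʳ (+-congˡ (Q-merge (suc n) n ≡.refl)) ⟩
        (1# + Q (suc (n ℕ.+ n)) + a + Q (suc (n ℕ.+ n))) * Θ
          ≈⟨ *-cong (solve 2 (λ d a → con true :+ d :+ a :+ d := con true :+ a) refl _ _) (sym θ-split) ⟩
        (1# + a) * θ-sum N (c n) ∎
        where
        A = 1# + Q (suc (n ℕ.+ n))
        a = q^ suc (2 ℕ.* n)
        b = Q (suc n)
        c₀ = c n 0
        c₁ = c n 1
        Θ = c₀ + (∑u + ∑v)
        S₁ = ∑ N (λ r → q^ τ (suc r) * c n (2 ℕ.+ r))
        S₂ = ∑ N (λ r → v (suc r) * c n (2 ℕ.+ r))
        S₄ = ∑ N (λ r → z r * c n r)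

        lem₁ : ∀ n → suc (2 ℕ.* n) ℕ.+ 1 ≡ 2 ℕ.* suc n
        lem₁ = solve-∀
        lem₂ : ∀ t n r → t ℕ.+ 2 ℕ.* suc r ℕ.+ 2 ℕ.* (2 ℕ.+ (n ℕ.+ r)) ≡ suc (2 ℕ.* n) ℕ.+ (t ℕ.+ 3 ℕ.* suc r ℕ.+ suc (suc r))
        lem₂ = solve-∀
        lem₃ : ∀ t n r → t ℕ.+ suc r ℕ.+ 2 ℕ.* (2 ℕ.+ (n ℕ.+ r)) ≡ 2 ℕ.* suc n ℕ.+ (t ℕ.+ 3 ℕ.* suc r)
        lem₃ = solve-∀
        lem₄ : ∀ t r d → t ℕ.+ 2 ℕ.* suc r ℕ.+ 2 ℕ.* d ≡ 2 ℕ.* suc (r ℕ.+ d) ℕ.+ t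
        lem₄ = solve-∀
        lem₅ : ∀ r d → r ℕ.+ suc r ℕ.+ 2 ℕ.* d ≡ suc (2 ℕ.* (r ℕ.+ d))
        lem₅ = solve-∀

        cancel : ∀ {x y w} → y + x ≈ w → x ≈ w + y
        cancel {x} {y} eq = trans (solve 2 (λ x y → x := (y :+ x) :+ y) refl x y) (+-congʳ eq)

        S₁≈ : S₁ ≈ ∑T₁ + c₁
        S₁≈ = trans (cancel (∑-shift N (λ r → q^ τ r * c n (suc r)) (c-tail _ (n≤1+n N))))
                    (+-congˡ (trans (*-congʳ q^0≈1) (*-identityˡ _)))

        S₂≈ : S₂ ≈ ∑v + q^ 1 * c₁
        S₂≈ = cancel (∑-shift N (λ r → v r * c n (suc r)) (c-tail _ (n≤1+n N)))

        S₄≈ : S₄ ≈ c₀ + ∑u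
        S₄≈ = sym (trans (+-congʳ (sym (*-identityˡ _))) (∑-shift N (λ r → z r * c n r) (c-tail _ ≤-refl)))

        -- `u r` times Q^{n-r} has exponent 2(n+1) + τ r, and `v r` times Q^{n-r} has exponent
        -- (2n+1) + τ r - r. For r > n the subtraction truncates, but both sides are zero.
        lower : ∀ r → Dec (r ≤ n) →
          (u r + v r) * (Q (n ∸ r) * c n r) ≈ b * (q^ τ r * c n r) + a * (z r * c n r)
        lower r (no r≰n) = trans (*-congˡ (trans (*-congˡ e) (zeroʳ _))) (trans (zeroʳ _)
          (sym (trans (+-cong (trans (*-congˡ (trans (*-congˡ e) (zeroʳ _))) (zeroʳ _))
                              (trans (*-congˡ (trans (*-congˡ e) (zeroʳ _))) (zeroʳ _))) (+-identityˡ _))))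
          where e = c-zero (≰⇒> r≰n)
        lower r (yes r≤n) = begin
          (u r + v r) * (Q d * c n r)
            ≈⟨ solve 4 (λ u v e x → (u :+ v) :* (e :* x) := u :* e :* x :+ v :* e :* x) refl _ _ _ _ ⟩
          u r * Q d * c n r + v r * Q d * c n r
            ≈⟨ +-cong (*-congʳ (trans (q^-merge (≡.trans (lem₄ (τ r) r d) (≡.cong (λ k → 2 ℕ.* suc k ℕ.+ τ r) r+d≡n))) (q^-+ _ _)))
                      (*-congʳ vQ) ⟩
          b * q^ τ r * c n r + a * z r * c n r
            ≈⟨ +-cong (*-assoc _ _ _) (*-assoc _ _ _) ⟩
          b * (q^ τ r * c n r) + a * (z r * c n r) ∎
          where
          d = n ∸ r
          r+d≡n = m+[n∸m]≡n r≤n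
          vQ : v r * Q d ≈ a * z r
          vQ = begin
            q^ (τ r ℕ.+ suc r) * Q d          ≈⟨ *-congʳ (trans (q^-+ _ _) (*-congʳ (sym (z-merge r)))) ⟩
            z r * q^ r * q^ suc r * Q d       ≈⟨ solve 4 (λ z a b d → z :* a :* b :* d := (a :* b :* d) :* z) refl _ _ _ _ ⟩
            (q^ r * q^ suc r * Q d) * z r     ≈⟨ *-congʳ (trans (*-congʳ (q^-merge ≡.refl)) (q^-merge (≡.trans (lem₅ r d) (≡.cong (λ k → suc (2 ℕ.* k)) r+d≡n)))) ⟩
            a * z r ∎

        -- The roles are exchanged here: `v r` yields the multiple of b and `u r` the multiple of a.
        upper : ∀ r → (u r + v r) * (Q (2 ℕ.+ (n ℕ.+ r)) * c n (2 ℕ.+ r)) ≈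
          b * (q^ τ (suc r) * c n (2 ℕ.+ r)) + a * (v (suc r) * c n (2 ℕ.+ r))
        upper r = begin
          (u r + v r) * (e * x)
            ≈⟨ solve 4 (λ u v e x → (u :+ v) :* (e :* x) := v :* e :* x :+ u :* e :* x) refl _ _ _ _ ⟩
          v r * e * x + u r * e * x
            ≈⟨ +-cong (*-congʳ (trans (q^-merge (lem₃ (τ r) n r)) (q^-+ _ _))) (*-congʳ (trans (q^-merge (lem₂ (τ r) n r)) (q^-+ _ _))) ⟩
          b * q^ τ (suc r) * x + a * v (suc r) * x
            ≈⟨ +-cong (*-assoc _ _ _) (*-assoc _ _ _) ⟩
          b * (q^ τ (suc r) * x) + a * (v (suc r) * x) ∎
          where
          e = Q (2 ℕ.+ (n ℕ.+ r))
          x = c n (2 ℕ.+ r)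

        pointwise : ∀ r → (u r + v r) * c (suc n) (suc r) ≈
          A * (u r * c n (suc r) + v r * c n (suc r))
          + (b * (q^ τ (suc r) * c n (2 ℕ.+ r)) + a * (v (suc r) * c n (2 ℕ.+ r)))
          + (b * (q^ τ r * c n r) + a * (z r * c n r))
        pointwise r = begin
          (u r + v r) * c (suc n) (suc r)
            ≈⟨ *-congˡ (c-step n r) ⟩
          (u r + v r) * (A * c n (suc r) + (e₁ + e₂))
            ≈⟨ solve 6 (λ u v A x p q → (u :+ v) :* (A :* x :+ (p :+ q))
                 := A :* (u :* x :+ v :* x) :+ (u :+ v) :* p :+ (u :+ v) :* q) refl _ _ _ _ e₁ e₂ ⟩
          A * (u r * c n (suc r) + v r * c n (suc r)) + (u r + v r) * e₁ + (u r + v r) * e₂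
            ≈⟨ +-cong (+-congˡ (upper r)) (lower r (r ≤? n)) ⟩
          _ ∎
          where
          e₁ = Q (2 ℕ.+ (n ℕ.+ r)) * c n (2 ℕ.+ r)
          e₂ = Q (n ∸ r) * c n r

        ∑-lin : ∀ x y f g → ∑ N (λ r → x * f r + y * g r) ≈ x * ∑ N f + y * ∑ N g
        ∑-lin x y f g = trans (∑-+ N _ _) (+-cong (∑-* N x f) (∑-* N y g))

        sums : ∑ N (λ r → A * (u r * c n (suc r) + v r * c n (suc r))
          + (b * (q^ τ (suc r) * c n (2 ℕ.+ r)) + a * (v (suc r) * c n (2 ℕ.+ r)))
          + (b * (q^ τ r * c n r) + a * (z r * c n r)))
          ≈ A * (∑u + ∑v) + (b * S₁ + a * S₂) + (b * ∑T₀ + a * (c₀ + ∑u))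
        sums = trans (∑-+ N _ _) (+-cong
          (trans (∑-+ N _ _) (+-cong (trans (∑-* N A _) (*-congˡ (∑-+ N _ _))) (∑-lin b a _ _)))
          (trans (∑-lin b a _ _) (+-congˡ (*-congˡ S₄≈))))

    oddProduct : ℕ → Carrier
    oddProduct zero    = 1#
    oddProduct (suc k) = oddProduct k * (1# + q^ suc (2 ℕ.* k))

    -- One cut-off N serves all k ≤ N, which later permits the interchange of the sums over k and r.
    oddProduct-θ : ∀ k N → k ≤ N → oddProduct k ≈ θ-sum N (c k)
    oddProduct-θ zero    N k≤N = sym (trans (+-congˡ (trans (∑-cong N (λ r → zeroʳ _)) (∑-0 N))) (+-identityʳ _))
    oddProduct-θ (suc k) N k<N = trans (*-comm _ _)
      (trans (*-congˡ (oddProduct-θ k N (<⇒≤ k<N))) (sym (θ-step k N k<N)))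

    -- The products (Q;Q)_{s+l} / (Q;Q)_s modulo 2, and q-Vandermonde.

    P : ℕ → ℕ → Carrier
    P s zero    = 1#
    P s (suc l) = P s l * (1# + Q (s ℕ.+ suc l))

    P-+ : ∀ s l l′ → P s (l ℕ.+ l′) ≈ P s l * P (s ℕ.+ l) l′
    P-+ s l zero = trans (reflexive (≡.cong (P s) (n+0≡n l))) (sym (*-identityʳ _))
    P-+ s l (suc l′) rewrite +-suc l l′ = trans
      (*-cong (P-+ s l l′) (+-congˡ (reflexive (≡.cong Q (lem s l l′))))) (*-assoc _ _ _)
      where
      lem : ∀ s l l′ → s ℕ.+ suc (l ℕ.+ l′) ≡ s ℕ.+ l ℕ.+ suc l′
      lem = solve-∀

    P-absorb : ∀ x s l → (∀ i → x * Q (s ℕ.+ suc i) ≈ 0#) → x * P s l ≈ x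
    P-absorb x s zero    h = *-identityʳ x
    P-absorb x s (suc l) h = begin
      x * (P s l * (1# + Q (s ℕ.+ suc l)))
        ≈⟨ solve 3 (λ x p e → x :* (p :* (con true :+ e)) := x :* p :+ x :* e :* p) refl _ _ _ ⟩
      x * P s l + x * Q (s ℕ.+ suc l) * P s l
        ≈⟨ +-cong (P-absorb x s l h) (trans (*-congʳ (h l)) (zeroˡ _)) ⟩
      x + 0# ≈⟨ +-identityʳ x ⟩
      x ∎

    -- The quotient formula for [N+m choose m] with the denominator (Q;Q)_m cleared, obtained by
    -- iterating `G-absorb`.
    G*P : ∀ N m → G (N ℕ.+ m) m * P 0 m ≈ P N m
    G*P N zero    = *-identityʳ _
    G*P N (suc m) rewrite +-suc N m = begin
      G (suc (N ℕ.+ m)) (suc m) * (P 0 m * (1# + Q (suc m)))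
        ≈⟨ solve 3 (λ g p e → g :* (p :* e) := g :* e :* p) refl _ _ _ ⟩
      G (suc (N ℕ.+ m)) (suc m) * (1# + Q (suc m)) * P 0 m
        ≈⟨ *-congʳ (G-absorb (m≤n+m m N)) ⟩
      (1# + Q (suc (N ℕ.+ m))) * G (N ℕ.+ m) m * P 0 m
        ≈⟨ trans (*-assoc _ _ _) (trans (*-comm _ _) (*-congʳ (G*P N m))) ⟩
      P N m * (1# + Q (suc (N ℕ.+ m))) ∎

    -- With (Q)ₙ = (1+Q)⋯(1+Qⁿ), the terms of q-Vandermonde: Σₘ Q^{m(m+a)} [M choose m] / (Q)ₘ₊ₐ = 1 / (Q)_{M+a},
    -- multiplied by (Q)_{M+a}.
    vandermonde-term : ℕ → ℕ → ℕ → Carrier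
    vandermonde-term M a m = Q (m ℕ.* (m ℕ.+ a)) * (G M m * P (m ℕ.+ a) (M ∸ m))

    -- Split [M+1 choose m+1] by the second Pascal rule. In the first half Q^{M-m} completes the
    -- exponent (m+1)(m+1+a) to (a+M+1) + m(m+a+1), so a grows by one. In the second half the last
    -- factor 1 + Q^{a+M+1} comes off the product.
    vandermonde-term-suc : ∀ M a m → vandermonde-term (suc M) a (suc m) ≈
      Q (a ℕ.+ suc M) * vandermonde-term M (suc a) m + (1# + Q (a ℕ.+ suc M)) * vandermonde-term M a (suc m)
    vandermonde-term-suc M a m = begin
      x * (G (suc M) (suc m) * P (suc m ℕ.+ a) (M ∸ m))
        ≈⟨ *-congˡ (*-congʳ (G-pascal M m)) ⟩
      x * ((Q (M ∸ m) * G M m + G M (suc m)) * P (suc m ℕ.+ a) (M ∸ m))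
        ≈⟨ solve 5 (λ x y g h p → x :* ((y :* g :+ h) :* p) := x :* y :* (g :* p) :+ x :* (h :* p)) refl _ _ _ _ _ ⟩
      x * Q (M ∸ m) * (G M m * P (suc m ℕ.+ a) (M ∸ m)) + x * (G M (suc m) * P (suc m ℕ.+ a) (M ∸ m))
        ≈⟨ +-cong (first (m ≤? M)) (second (suc m ≤? M)) ⟩
      e * vandermonde-term M (suc a) m + (1# + e) * vandermonde-term M a (suc m) ∎
      where
      x = Q (suc m ℕ.* (suc m ℕ.+ a))
      e = Q (a ℕ.+ suc M)

      lem₁ : ∀ m a d → suc m ℕ.* (suc m ℕ.+ a) ℕ.+ d ≡ a ℕ.+ suc (m ℕ.+ d) ℕ.+ m ℕ.* (m ℕ.+ suc a)
      lem₁ = solve-∀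
      lem₂ : ∀ m a d → suc m ℕ.+ a ℕ.+ suc d ≡ a ℕ.+ suc (suc m ℕ.+ d)
      lem₂ = solve-∀

      vanish : ∀ {g} x p → g ≈ 0# → x * (g * p) ≈ 0#
      vanish x p g≈0 = trans (*-congˡ (trans (*-congʳ g≈0) (zeroˡ _))) (zeroʳ _)

      first : Dec (m ≤ M) → x * Q (M ∸ m) * (G M m * P (suc m ℕ.+ a) (M ∸ m)) ≈ e * vandermonde-term M (suc a) m
      first (no m≰M)  = trans (vanish _ _ g) (sym (trans (*-congˡ (vanish _ _ g)) (zeroʳ _)))
        where g = G-zero (≰⇒> m≰M)
      first (yes m≤M) = trans (*-cong
        (trans (Q-merge (suc m ℕ.* (suc m ℕ.+ a)) (M ∸ m)
                  (≡.trans (lem₁ m a (M ∸ m)) (≡.cong (λ k → a ℕ.+ suc k ℕ.+ m ℕ.* (m ℕ.+ suc a)) (m+[n∸m]≡n m≤M))))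
               (sym (Q-merge (a ℕ.+ suc M) (m ℕ.* (m ℕ.+ suc a)) ≡.refl)))
        (*-congˡ (reflexive (≡.cong (λ s → P s (M ∸ m)) (≡.sym (+-suc m a)))))) (*-assoc _ _ _)

      second : Dec (m < M) → x * (G M (suc m) * P (suc m ℕ.+ a) (M ∸ m)) ≈ (1# + e) * vandermonde-term M a (suc m)
      second (no m≮M)  = trans (vanish _ _ g) (sym (trans (*-congˡ (vanish _ _ g)) (zeroʳ _)))
        where g = G-zero (≰⇒> m≮M)
      second (yes m<M) = begin
        x * (G M (suc m) * P (suc m ℕ.+ a) (M ∸ m))
          ≡⟨ ≡.cong (λ l → x * (G M (suc m) * P (suc m ℕ.+ a) l)) (∸-suc m<M) ⟩
        x * (G M (suc m) * (P (suc m ℕ.+ a) (M ∸ suc m) * (1# + Q (suc m ℕ.+ a ℕ.+ suc (M ∸ suc m)))))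
          ≈⟨ *-congˡ (*-congˡ (*-congˡ (+-congˡ (reflexive (≡.cong Q
               (≡.trans (lem₂ m a (M ∸ suc m)) (≡.cong (λ k → a ℕ.+ suc k) (m+[n∸m]≡n m<M)))))))) ⟩
        x * (G M (suc m) * (P (suc m ℕ.+ a) (M ∸ suc m) * (1# + e)))
          ≈⟨ solve 4 (λ x g p e → x :* (g :* (p :* e)) := e :* (x :* (g :* p))) refl _ _ _ _ ⟩
        (1# + e) * vandermonde-term M a (suc m) ∎
        where
        ∸-suc : ∀ {m n} → m < n → n ∸ m ≡ suc (n ∸ suc m)
        ∸-suc {zero}  (s≤s _)   = ≡.refl
        ∸-suc {suc m} (s≤s m<n) = ∸-suc m<n

    -- The weights e and 1 + e of the recurrence add up to 1, so two sums equal to 1 produce another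
    -- one. The upper limit is left free because the induction uses the case M with two different
    -- limits.
    vandermonde : ∀ M a L → M ≤ L → ∑ (suc L) (vandermonde-term M a) ≈ 1#
    vandermonde zero    a L M≤L = trans (+-cong
      (trans (*-cong q^0≈1 (*-identityˡ _)) (*-identityˡ _))
      (trans (∑-cong L (λ m → trans (*-congˡ (zeroˡ _)) (zeroʳ _))) (∑-0 L))) (+-identityʳ _)
    vandermonde (suc M) a (suc L) (s≤s M≤L) = begin
      vandermonde-term (suc M) a 0 + ∑ (suc L) (λ m → vandermonde-term (suc M) a (suc m))
        ≈⟨ +-cong (solve 4 (λ y x p e → y :* (x :* (p :* e)) := e :* (y :* (x :* p))) refl (Q 0) 1# (P a M) (1# + e))
                  (trans (∑-cong (suc L) (vandermonde-term-suc M a)) (trans (∑-+ (suc L) (λ m → e * vandermonde-term M (suc a) m) (λ m → (1# + e) * vandermonde-term M a (suc m)))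
                  (+-cong (∑-* (suc L) e (vandermonde-term M (suc a))) (∑-* (suc L) (1# + e) (λ m → vandermonde-term M a (suc m)))))) ⟩
      (1# + e) * vandermonde-term M a 0
        + (e * ∑ (suc L) (vandermonde-term M (suc a)) + (1# + e) * ∑ (suc L) (λ m → vandermonde-term M a (suc m)))
        ≈⟨ solve 4 (λ e x y w → (con true :+ e) :* x :+ (e :* y :+ (con true :+ e) :* w) := e :* y :+ (con true :+ e) :* (x :+ w)) refl _ _ _ _ ⟩
      e * ∑ (suc L) (vandermonde-term M (suc a)) + (1# + e) * ∑ (2 ℕ.+ L) (vandermonde-term M a)
        ≈⟨ +-cong (*-congˡ (vandermonde M (suc a) L M≤L)) (*-congˡ (vandermonde M a (suc L) (m≤n⇒m≤1+n M≤L))) ⟩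
      e * 1# + (1# + e) * 1#
        ≈⟨ solve 1 (λ e → e :* con true :+ (con true :+ e) :* con true := con true) refl _ ⟩
      1# ∎
      where e = Q (a ℕ.+ suc M)

    -- The truncated Durfee rectangle sum and the Rogers-Selberg identity.

    module _ {K : ℕ} (q^-nilpotent : ∀ i → K ≤ i → q^ i ≈ 0#) (n : ℕ) (K≤n : K ≤ n) where

      -- The product over 2k < i ≤ 2n for k ≤ n. The upper end does not depend on k, and the factors
      -- beyond it are 1 modulo q^K.
      tail : ℕ → Carrier
      tail k = P (k ℕ.+ k) ((n ∸ k) ℕ.+ (n ∸ k))

      Q-Q-vanish : ∀ i j → n ≤ i ℕ.+ j → Q i * Q j ≈ 0#
      Q-Q-vanish i j n≤ = trans (Q-merge i j ≡.refl) (q^-nilpotent _ (≤-trans K≤n (≤-trans n≤ (m≤m+n _ _))))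

      -- With k = r + m, the numerator (Q;Q)_{2k} of [2k choose m] cancels against the start of the
      -- tail, and k² = r² + m(m+2r). This would give a term of q-Vandermonde with 1 / (Q;Q)_m in
      -- place of [m+d choose m]; the discrepancy, `P d m`, is invisible next to Q^{k²}.
      durfee-term : ∀ r m d → r ℕ.+ (m ℕ.+ d) ≡ n →
        Q ((r ℕ.+ m) ℕ.* (r ℕ.+ m)) * (c (r ℕ.+ m) r * P ((r ℕ.+ m) ℕ.+ (r ℕ.+ m)) (d ℕ.+ d))
        ≈ (Q (r ℕ.* r) * P (n ℕ.+ r) (m ℕ.+ d)) * (Q (m ℕ.* (m ℕ.+ (r ℕ.+ r))) * (G (m ℕ.+ d) m * P (m ℕ.+ (r ℕ.+ r)) d))
      durfee-term r m d ≡.refl = sym (begin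
        (Q (r ℕ.* r) * P (n ℕ.+ r) (m ℕ.+ d)) * (Q (m ℕ.* s) * (G (m ℕ.+ d) m * P s d))
          ≈⟨ solve 5 (λ a b x g p → (a :* b) :* (x :* (g :* p)) := (a :* x) :* (g :* (p :* b))) refl _ _ _ _ _ ⟩
        (Q (r ℕ.* r) * Q (m ℕ.* s)) * (G (m ℕ.+ d) m * (P s d * P (n ℕ.+ r) (m ℕ.+ d)))
          ≈⟨ *-cong (Q-merge (r ℕ.* r) (m ℕ.* s) (lem₁ r m)) (*-congˡ regroup) ⟩
        Q (k ℕ.* k) * (G (m ℕ.+ d) m * (c k r * P 0 m * P (k ℕ.+ k) (d ℕ.+ d)))
          ≈⟨ solve 5 (λ x g c p w → x :* (g :* (c :* p :* w)) := (x :* (g :* p)) :* (c :* w)) refl _ _ _ _ _ ⟩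
        (Q (k ℕ.* k) * (G (m ℕ.+ d) m * P 0 m)) * (c k r * P (k ℕ.+ k) (d ℕ.+ d))
          ≈⟨ *-congʳ (*-congˡ (trans (*-congʳ (reflexive (≡.cong (λ N → G N m) (+-comm′ m d)))) (G*P d m))) ⟩
        (Q (k ℕ.* k) * P d m) * (c k r * P (k ℕ.+ k) (d ℕ.+ d))
          -- Each factor of `P d m` is 1 + Q^j with j > d, and k² + j ≥ k + d = n, so the product of
          -- Q^{k²} and Q^j is zero.
          ≈⟨ *-congʳ (P-absorb _ d m λ i → Q-Q-vanish (k ℕ.* k) (d ℕ.+ suc i)
               (≡.subst (_≤ k ℕ.* k ℕ.+ (d ℕ.+ suc i)) (lem₂ r m d) (+-mono-≤ (k≤k*k k) (m≤m+n d (suc i))))) ⟩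
        Q (k ℕ.* k) * (c k r * P (k ℕ.+ k) (d ℕ.+ d)) ∎)
        where
        k = r ℕ.+ m
        s = m ℕ.+ (r ℕ.+ r)

        lem₁ : ∀ r m → r ℕ.* r ℕ.+ m ℕ.* (m ℕ.+ (r ℕ.+ r)) ≡ (r ℕ.+ m) ℕ.* (r ℕ.+ m)
        lem₁ = solve-∀
        lem₂ : ∀ r m d → r ℕ.+ m ℕ.+ d ≡ r ℕ.+ (m ℕ.+ d)
        lem₂ = solve-∀
        lem₃ : ∀ r m d → r ℕ.+ (m ℕ.+ d) ℕ.+ r ≡ m ℕ.+ (r ℕ.+ r) ℕ.+ d
        lem₃ = solve-∀
        lem₄ : ∀ m d → d ℕ.+ (m ℕ.+ d) ≡ m ℕ.+ (d ℕ.+ d)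
        lem₄ = solve-∀
        lem₅ : ∀ r m → m ℕ.+ (r ℕ.+ r) ℕ.+ m ≡ (r ℕ.+ m) ℕ.+ (r ℕ.+ m)
        lem₅ = solve-∀
        lem₆ : ∀ r m → (r ℕ.+ m) ℕ.+ (r ℕ.+ m) ≡ (r ℕ.+ m ℕ.+ r) ℕ.+ m
        lem₆ = solve-∀
        +-comm′ : ∀ m d → m ℕ.+ d ≡ d ℕ.+ m
        +-comm′ = solve-∀

        k≤k*k : ∀ k → k ≤ k ℕ.* k
        k≤k*k zero    = z≤n
        k≤k*k (suc k) = m≤m+n _ _

        c≈G : G (k ℕ.+ k) m ≈ c k r
        c≈G = ≡.subst (λ N → G N m ≈ G N (k ℕ.+ r)) (≡.sym (lem₆ r m)) (sym (G-sym (k ℕ.+ r) m))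

        -- Both sides describe the factors with s < i ≤ 2n: the left one cuts this range at s + d =
        -- n + r, the right one at s + m = 2k, where the first piece is rewritten through the
        -- binomial.
        regroup : P s d * P (n ℕ.+ r) (m ℕ.+ d) ≈ c k r * P 0 m * P (k ℕ.+ k) (d ℕ.+ d)
        regroup = begin
          P s d * P (n ℕ.+ r) (m ℕ.+ d)
            ≡⟨ ≡.cong (λ t → P s d * P t (m ℕ.+ d)) (lem₃ r m d) ⟩
          P s d * P (s ℕ.+ d) (m ℕ.+ d)         ≈⟨ P-+ s d (m ℕ.+ d) ⟨
          P s (d ℕ.+ (m ℕ.+ d))                 ≡⟨ ≡.cong (P s) (lem₄ m d) ⟩
          P s (m ℕ.+ (d ℕ.+ d))                 ≈⟨ P-+ s m (d ℕ.+ d) ⟩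
          P s m * P (s ℕ.+ m) (d ℕ.+ d)         ≈⟨ *-congʳ (sym (G*P s m)) ⟩
          G (s ℕ.+ m) m * P 0 m * P (s ℕ.+ m) (d ℕ.+ d)
            ≡⟨ ≡.cong (λ t → G t m * P 0 m * P t (d ℕ.+ d)) (lem₅ r m) ⟩
          G (k ℕ.+ k) m * P 0 m * P (k ℕ.+ k) (d ℕ.+ d)  ≈⟨ *-congʳ (*-congʳ c≈G) ⟩
          c k r * P 0 m * P (k ℕ.+ k) (d ℕ.+ d) ∎

      -- The terms with k < r vanish and the others are q-Vandermonde with M = n - r and a = 2r. The
      -- product left over has only factors with i > n ≥ K, hence equals 1 here.
      durfee : ∀ r → r ≤ n → ∑ (suc n) (λ k → Q (k ℕ.* k) * (c k r * tail k)) ≈ Q (r ℕ.* r)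
      durfee r r≤n = begin
        ∑ (suc n) f
          ≡⟨ ≡.cong (λ N → ∑ N f) (≡.trans (≡.cong suc (≡.sym r+M≡n)) (≡.sym (+-suc r M))) ⟩
        ∑ (r ℕ.+ suc M) f
          ≈⟨ ∑-drop r (suc M) f (λ k k<r → trans (*-congˡ (trans (*-congʳ (c-zero k<r)) (zeroˡ _))) (zeroʳ _)) ⟩
        ∑ (suc M) (λ m → f (r ℕ.+ m))
          ≈⟨ trans (∑-cong< (suc M) (λ m m<1+M → term m (ℕₚ.≤-pred m<1+M))) (∑-* (suc M) _ (vandermonde-term M (r ℕ.+ r))) ⟩
        (Q (r ℕ.* r) * P (n ℕ.+ r) M) * ∑ (suc M) (vandermonde-term M (r ℕ.+ r))
          ≈⟨ trans (*-congˡ (vandermonde M (r ℕ.+ r) M ≤-refl)) (*-identityʳ _) ⟩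
        Q (r ℕ.* r) * P (n ℕ.+ r) M
          ≈⟨ P-absorb _ (n ℕ.+ r) M (λ i → Q-Q-vanish (r ℕ.* r) (n ℕ.+ r ℕ.+ suc i)
               (≤-trans (≤-trans (m≤m+n n r) (m≤m+n _ (suc i))) (m≤n+m _ (r ℕ.* r)))) ⟩
        Q (r ℕ.* r) ∎
        where
        M = n ∸ r
        f : ℕ → Carrier
        f k = Q (k ℕ.* k) * (c k r * tail k)
        r+M≡n = m+[n∸m]≡n r≤n

        term : ∀ m → m ≤ M → f (r ℕ.+ m) ≈ (Q (r ℕ.* r) * P (n ℕ.+ r) M) * vandermonde-term M (r ℕ.+ r) m
        term m m≤M = ≡.subst₂ (λ d M′ → Q (k ℕ.* k) * (c k r * P (k ℕ.+ k) (d ℕ.+ d)) ≈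
              (Q (r ℕ.* r) * P (n ℕ.+ r) M′) * (Q (m ℕ.* (m ℕ.+ (r ℕ.+ r))) * (G M′ m * P (m ℕ.+ (r ℕ.+ r)) (M ∸ m))))
            (ℕₚ.∸-+-assoc n r m) m+d≡M
            (durfee-term r m (M ∸ m) (≡.trans (≡.cong (r ℕ.+_) m+d≡M) r+M≡n))
          where
          k = r ℕ.+ m
          m+d≡M = m+[n∸m]≡n m≤M

      -- Insert the theta expansion of each odd product and sum over k first: r contributes
      -- q^{r(3r+1)/2} Q^{r²}, whose exponent is (7r²+r)/2.
      rogers-selberg :
        ∑ (suc n) (λ k → Q (k ℕ.* k) * (oddProduct k * tail k)) ≈
        1# + ∑ n (λ r → q^ exponent⁺ r + q^ exponent⁻ r)
      rogers-selberg = begin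
        ∑ (suc n) (λ k → Q (k ℕ.* k) * (oddProduct k * tail k))
          ≈⟨ ∑-cong< (suc n) (λ k k<1+n → trans (*-congˡ (*-congʳ (oddProduct-θ k n (ℕₚ.≤-pred k<1+n)))) (expand k)) ⟩
        ∑ (suc n) (λ k → θ-sum n (h k))
          ≈⟨ trans (∑-+ (suc n) (λ k → h k 0) (λ k → ∑ n (λ r → (u r + v r) * h k (suc r))))
               (+-congˡ (trans (∑-swap (suc n) n (λ k r → (u r + v r) * h k (suc r)))
                 (∑-cong n (λ r → ∑-* (suc n) (u r + v r) (λ k → h k (suc r)))))) ⟩
        θ-sum n (λ r → ∑ (suc n) (λ k → h k r))
          ≈⟨ +-cong (trans (durfee 0 z≤n) q^0≈1) (∑-cong< n (λ r r<n → trans (*-congˡ (durfee (suc r) r<n))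
               (trans (distribʳ _ _ _) (+-cong (q^-merge ≡.refl) (q^-merge ≡.refl))))) ⟩
        _ ∎
        where
        h : ℕ → ℕ → Carrier
        h k r = Q (k ℕ.* k) * (c k r * tail k)

        expand : ∀ k → Q (k ℕ.* k) * (θ-sum n (c k) * tail k) ≈ θ-sum n (h k)
        expand k = begin
          Q (k ℕ.* k) * ((c k 0 + S) * tail k)
            ≈⟨ solve 4 (λ x c s t → x :* ((c :+ s) :* t) := x :* (c :* t) :+ x :* t :* s) refl _ _ _ _ ⟩
          h k 0 + Q (k ℕ.* k) * tail k * S
            ≈⟨ +-congˡ (trans (sym (∑-* n _ _)) (∑-cong n (λ r →
                 solve 4 (λ x t w c → x :* t :* (w :* c) := w :* (x :* (c :* t))) refl _ _ _ _))) ⟩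
          θ-sum n (h k) ∎
          where S = ∑ n (λ r → (u r + v r) * c k (suc r))

open RogersSelberg using (τ; exponent⁺; exponent⁻; Monomials; module QSeries)

-- Polynomials over 𝔽₂ as lists of exponents.

module GeneratingFunctions where

  open import Algebra.Bundles using (CommutativeSemiring)
  open import Algebra.Structures.Biased using (isCommutativeSemiringˡ)
  open import Data.Bool using (Bool; false; _xor_)
  open import Data.Bool.Properties using (xor-comm; xor-assoc; xor-same; xor-identityʳ)
  open import Data.List using (List; []; _∷_; _++_; map; concat; applyUpTo; cartesianProduct)
  open import Data.List.Properties using (map-++; map-∘)
  open import Data.Nat.ListAction using (sum)
  open import Data.Nat.ListAction.Properties using (sum-++)
  open import Data.Product using (_,_; uncurry)
  open import Data.Nat using (ℕ; zero; suc; _≤_; _∸_)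
  import Data.Nat as ℕ
  import Data.Nat.Properties as ℕₚ
  open import Data.Nat.Tactic.RingSolver using (solve-∀)
  open import Level using (0ℓ)
  open import Relation.Binary using (IsEquivalence)
  open import Relation.Binary.PropositionalEquality as ≡ using (_≡_)

  -- The value on f of the 𝔽₂-linear functional that sends q^i to φ i; the indicator of n extracts
  -- the coefficient of q^n.
  ⟪_,_⟫ : List ℕ → (ℕ → Bool) → Bool
  ⟪ []    , φ ⟫ = false
  ⟪ x ∷ f , φ ⟫ = φ x xor ⟪ f , φ ⟫

  ⟪⟫-++ : ∀ f g φ → ⟪ f ++ g , φ ⟫ ≡ ⟪ f , φ ⟫ xor ⟪ g , φ ⟫
  ⟪⟫-++ []      g φ = ≡.refl
  ⟪⟫-++ (x ∷ f) g φ = ≡.trans (≡.cong (φ x xor_) (⟪⟫-++ f g φ)) (≡.sym (xor-assoc (φ x) _ _))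

  ⟪⟫-map : ∀ h f φ → ⟪ map h f , φ ⟫ ≡ ⟪ f , (λ x → φ (h x)) ⟫
  ⟪⟫-map h []      φ = ≡.refl
  ⟪⟫-map h (x ∷ f) φ = ≡.cong (φ (h x) xor_) (⟪⟫-map h f φ)

  ⟪⟫-cong : ∀ f {φ ψ : ℕ → Bool} → (∀ x → φ x ≡ ψ x) → ⟪ f , φ ⟫ ≡ ⟪ f , ψ ⟫
  ⟪⟫-cong []      h = ≡.refl
  ⟪⟫-cong (x ∷ f) h = ≡.cong₂ _xor_ (h x) (⟪⟫-cong f h)

  ⟪⟫-zero : ∀ f {φ : ℕ → Bool} → (∀ x → φ x ≡ false) → ⟪ f , φ ⟫ ≡ false
  ⟪⟫-zero []      h = ≡.refl
  ⟪⟫-zero (x ∷ f) h = ≡.cong₂ _xor_ (h x) (⟪⟫-zero f h)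

  xor-interchange : ∀ a b c d → (a xor b) xor (c xor d) ≡ (a xor c) xor (b xor d)
  xor-interchange a b c d = begin
    (a xor b) xor (c xor d)  ≡⟨ xor-assoc a b _ ⟩
    a xor (b xor (c xor d))  ≡⟨ ≡.cong (a xor_) (xor-assoc b c d) ⟨
    a xor ((b xor c) xor d)  ≡⟨ ≡.cong (λ e → a xor (e xor d)) (xor-comm b c) ⟩
    a xor ((c xor b) xor d)  ≡⟨ ≡.cong (a xor_) (xor-assoc c b d) ⟩
    a xor (c xor (b xor d))  ≡⟨ xor-assoc a c _ ⟨
    (a xor c) xor (b xor d)  ∎
    where open ≡.≡-Reasoning

  ⟪⟫-xor : ∀ f φ ψ → ⟪ f , (λ x → φ x xor ψ x) ⟫ ≡ ⟪ f , φ ⟫ xor ⟪ f , ψ ⟫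
  ⟪⟫-xor []      φ ψ = ≡.refl
  ⟪⟫-xor (x ∷ f) φ ψ = ≡.trans (≡.cong ((φ x xor ψ x) xor_) (⟪⟫-xor f φ ψ)) (xor-interchange (φ x) _ _ _)

  ⟪⟫-swap : ∀ f g (φ : ℕ → ℕ → Bool) →
    ⟪ f , (λ x → ⟪ g , φ x ⟫) ⟫ ≡ ⟪ g , (λ y → ⟪ f , (λ x → φ x y) ⟫) ⟫
  ⟪⟫-swap []      g φ = ≡.sym (⟪⟫-zero g (λ _ → ≡.refl))
  ⟪⟫-swap (x ∷ f) g φ = ≡.trans (≡.cong (⟪ g , φ x ⟫ xor_) (⟪⟫-swap f g φ)) (≡.sym (⟪⟫-xor g (φ x) _))

  infixl 7 _⊛_
  _⊛_ : List ℕ → List ℕ → List ℕ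
  []      ⊛ g = []
  (x ∷ f) ⊛ g = map (x ℕ.+_) g ++ f ⊛ g

  -- Testing a product becomes testing one factor at a time, so the ring laws reduce to exchanging
  -- nested tests and to laws of addition on ℕ.
  ⟪⟫-⊛ : ∀ f g φ → ⟪ f ⊛ g , φ ⟫ ≡ ⟪ f , (λ x → ⟪ g , (λ y → φ (x ℕ.+ y)) ⟫) ⟫
  ⟪⟫-⊛ []      g φ = ≡.refl
  ⟪⟫-⊛ (x ∷ f) g φ = ≡.trans (⟪⟫-++ (map (x ℕ.+_) g) _ φ)
    (≡.cong₂ _xor_ (⟪⟫-map (x ℕ.+_) g φ) (⟪⟫-⊛ f g φ))

  -- 𝔽₂[q]/(q^K): a list of exponents stands for the sum of the corresponding monomials, and
  -- two such sums agree when no linear functional that kills q^i for all i ≥ K separates them.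
  module Truncated (K : ℕ) where

    record _≋_ (f g : List ℕ) : Set where
      constructor mk≋
      field
        ⟪⟫-eq : ∀ φ → (∀ i → K ≤ i → φ i ≡ false) → ⟪ f , φ ⟫ ≡ ⟪ g , φ ⟫
    open _≋_ public

    ≋-exact : ∀ {f g} → (∀ φ → ⟪ f , φ ⟫ ≡ ⟪ g , φ ⟫) → f ≋ g
    ≋-exact h = mk≋ (λ φ _ → h φ)

    ++-cong : ∀ {f f′ g g′} → f ≋ f′ → g ≋ g′ → (f ++ g) ≋ (f′ ++ g′)
    ++-cong {f} {f′} {g} {g′} p r = mk≋ λ φ z →
      ≡.trans (⟪⟫-++ f g φ) (≡.trans (≡.cong₂ _xor_ (⟪⟫-eq p φ z) (⟪⟫-eq r φ z)) (≡.sym (⟪⟫-++ f′ g′ φ)))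

    ++-comm : ∀ f g → (f ++ g) ≋ (g ++ f)
    ++-comm f g = ≋-exact λ φ →
      ≡.trans (⟪⟫-++ f g φ) (≡.trans (xor-comm ⟪ f , φ ⟫ _) (≡.sym (⟪⟫-++ g f φ)))

    ++-assoc : ∀ f g h → ((f ++ g) ++ h) ≋ (f ++ (g ++ h))
    ++-assoc f g h = ≋-exact λ φ → ≡.cong (λ l → ⟪ l , φ ⟫) (Data.List.Properties.++-assoc f g h)

    -- For fixed g, the functional x ↦ ⟪ g , φ(x + ·) ⟫ again kills all x ≥ K, since adding to an
    -- exponent keeps it ≥ K. This is the ideal property of (q^K).
    ⊛-cong : ∀ {f f′ g g′} → f ≋ f′ → g ≋ g′ → (f ⊛ g) ≋ (f′ ⊛ g′)
    ⊛-cong {f} {f′} {g} {g′} p r = mk≋ λ φ z → begin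
      ⟪ f ⊛ g , φ ⟫                                       ≡⟨ ⟪⟫-⊛ f g φ ⟩
      ⟪ f , (λ x → ⟪ g , (λ y → φ (x ℕ.+ y)) ⟫) ⟫
        ≡⟨ ⟪⟫-eq p _ (λ i K≤i → ⟪⟫-zero g (λ y → z _ (ℕₚ.≤-trans K≤i (ℕₚ.m≤m+n i y)))) ⟩
      ⟪ f′ , (λ x → ⟪ g , (λ y → φ (x ℕ.+ y)) ⟫) ⟫
        ≡⟨ ⟪⟫-cong f′ (λ x → ⟪⟫-eq r _ (λ i K≤i → z _ (ℕₚ.≤-trans K≤i (ℕₚ.m≤n+m i x)))) ⟩
      ⟪ f′ , (λ x → ⟪ g′ , (λ y → φ (x ℕ.+ y)) ⟫) ⟫       ≡⟨ ⟪⟫-⊛ f′ g′ φ ⟨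
      ⟪ f′ ⊛ g′ , φ ⟫                                     ∎
      where open ≡.≡-Reasoning

    ⊛-comm : ∀ f g → (f ⊛ g) ≋ (g ⊛ f)
    ⊛-comm f g = ≋-exact λ φ → begin
      ⟪ f ⊛ g , φ ⟫                                  ≡⟨ ⟪⟫-⊛ f g φ ⟩
      ⟪ f , (λ x → ⟪ g , (λ y → φ (x ℕ.+ y)) ⟫) ⟫    ≡⟨ ⟪⟫-swap f g _ ⟩
      ⟪ g , (λ y → ⟪ f , (λ x → φ (x ℕ.+ y)) ⟫) ⟫
        ≡⟨ ⟪⟫-cong g (λ y → ⟪⟫-cong f (λ x → ≡.cong φ (ℕₚ.+-comm x y))) ⟩
      ⟪ g , (λ y → ⟪ f , (λ x → φ (y ℕ.+ x)) ⟫) ⟫    ≡⟨ ⟪⟫-⊛ g f φ ⟨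
      ⟪ g ⊛ f , φ ⟫                                  ∎
      where open ≡.≡-Reasoning

    ⊛-assoc : ∀ f g h → ((f ⊛ g) ⊛ h) ≋ (f ⊛ (g ⊛ h))
    ⊛-assoc f g h = ≋-exact λ φ → begin
      ⟪ (f ⊛ g) ⊛ h , φ ⟫                                      ≡⟨ ⟪⟫-⊛ (f ⊛ g) h φ ⟩
      ⟪ f ⊛ g , (λ w → ⟪ h , (λ v → φ (w ℕ.+ v)) ⟫) ⟫          ≡⟨ ⟪⟫-⊛ f g _ ⟩
      ⟪ f , (λ x → ⟪ g , (λ y → ⟪ h , (λ v → φ (x ℕ.+ y ℕ.+ v)) ⟫) ⟫) ⟫
        ≡⟨ ⟪⟫-cong f (λ x → ⟪⟫-cong g (λ y → ⟪⟫-cong h (λ v → ≡.cong φ (ℕₚ.+-assoc x y v)))) ⟩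
      ⟪ f , (λ x → ⟪ g , (λ y → ⟪ h , (λ v → φ (x ℕ.+ (y ℕ.+ v))) ⟫) ⟫) ⟫
        ≡⟨ ⟪⟫-cong f (λ x → ⟪⟫-⊛ g h _) ⟨
      ⟪ f , (λ x → ⟪ g ⊛ h , (λ w → φ (x ℕ.+ w)) ⟫) ⟫          ≡⟨ ⟪⟫-⊛ f (g ⊛ h) φ ⟨
      ⟪ f ⊛ (g ⊛ h) , φ ⟫                                      ∎
      where open ≡.≡-Reasoning

    ⊛-identityˡ : ∀ f → ((0 ∷ []) ⊛ f) ≋ f
    ⊛-identityˡ f = ≋-exact λ φ → ≡.trans (⟪⟫-⊛ (0 ∷ []) f φ) (xor-identityʳ _)

    ⊛-distribʳ : ∀ h f g → ((f ++ g) ⊛ h) ≋ (f ⊛ h ++ g ⊛ h)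
    ⊛-distribʳ h f g = ≋-exact λ φ → ≡.trans (⟪⟫-⊛ (f ++ g) h φ) (≡.trans (⟪⟫-++ f g _)
      (≡.trans (≡.sym (≡.cong₂ _xor_ (⟪⟫-⊛ f h φ) (⟪⟫-⊛ g h φ))) (≡.sym (⟪⟫-++ (f ⊛ h) (g ⊛ h) φ))))

    ≋-refl : ∀ {f} → f ≋ f
    ≋-refl = ≋-exact (λ _ → ≡.refl)

    ≋-sym : ∀ {f g} → f ≋ g → g ≋ f
    ≋-sym p = mk≋ λ φ z → ≡.sym (⟪⟫-eq p φ z)

    ≋-trans : ∀ {f g h} → f ≋ g → g ≋ h → f ≋ h
    ≋-trans p r = mk≋ λ φ z → ≡.trans (⟪⟫-eq p φ z) (⟪⟫-eq r φ z)

    𝔽₂[q]/q^K : CommutativeSemiring 0ℓ 0ℓ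
    𝔽₂[q]/q^K = record
      { Carrier = List ℕ
      ; _≈_ = _≋_
      ; _+_ = _++_
      ; _*_ = _⊛_
      ; 0#  = []
      ; 1#  = 0 ∷ []
      ; isCommutativeSemiring = isCommutativeSemiringˡ record
        { +-isCommutativeMonoid = record
          { isMonoid = record
            { isSemigroup = record
              { isMagma = record { isEquivalence = isEquiv ; ∙-cong = ++-cong }
              ; assoc = ++-assoc }
            ; identity = (λ f → ≋-refl) , (λ f → ≋-trans (++-comm f []) ≋-refl) }
          ; comm = ++-comm }
        ; *-isCommutativeMonoid = record
          { isMonoid = record
            { isSemigroup = record
              { isMagma = record { isEquivalence = isEquiv ; ∙-cong = ⊛-cong }
              ; assoc = ⊛-assoc }
            ; identity = ⊛-identityˡ , (λ f → ≋-trans (⊛-comm f (0 ∷ [])) (⊛-identityˡ f)) }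
          ; comm = ⊛-comm }
        ; distribʳ = ⊛-distribʳ
        ; zeroˡ = λ f → ≋-refl
        }
      }
      where
      isEquiv : IsEquivalence _≋_
      isEquiv = record { refl = ≋-refl ; sym = ≋-sym ; trans = ≋-trans }

    monomials : Monomials 𝔽₂[q]/q^K
    monomials = record
      { 1+1≈0 = ≋-exact λ φ → ≡.trans (≡.cong (φ 0 xor_) (xor-identityʳ _)) (xor-same (φ 0))
      ; q^_   = _∷ []
      ; q^0≈1 = ≋-refl
      ; q^-+  = λ i j → ≋-refl
      }

    open QSeries 𝔽₂[q]/q^K monomials public

    q^-nilpotent : ∀ i → K ≤ i → (i ∷ []) ≋ []
    q^-nilpotent i K≤i = mk≋ λ φ z → ≡.cong (_xor false) (z i K≤i)

  -- The candidates and their generating polynomial.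

  -- Sets of even parts in the interval (2s, 2(s+l)], as decreasing lists.
  evenSets : ℕ → ℕ → List (List ℕ)
  evenSets s zero    = [] ∷ []
  evenSets s (suc l) = evenSets s l ++ map (2 ℕ.* (s ℕ.+ suc l) ∷_) (evenSets s l)

  -- Multisets with parts 1, 3, …, 2k−1, each two or three times, as non-increasing lists.
  oddMultisets : ℕ → List (List ℕ)
  oddMultisets zero    = [] ∷ []
  oddMultisets (suc k) = map (λ o → suc (2 ℕ.* k) ∷ suc (2 ℕ.* k) ∷ o)
    (oddMultisets k ++ map (suc (2 ℕ.* k) ∷_) (oddMultisets k))

  -- The even parts range over (4k, 4N]. The lower end encodes the bound 2(2k-1) + 4 = 4k + 2 (for k
  -- = 0, positivity in case (a)); the upper end makes the generating polynomial exactly `tail`.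
  block : ℕ → ℕ → List (List ℕ)
  block N k = map (uncurry _++_) (cartesianProduct (evenSets (k ℕ.+ k) ((N ∸ k) ℕ.+ (N ∸ k))) (oddMultisets k))

  candidates : ℕ → List (List ℕ)
  candidates N = concat (applyUpTo (block N) (suc N))

  map-sum-∷ : ∀ x ls → map sum (map (x ∷_) ls) ≡ map (x ℕ.+_) (map sum ls)
  map-sum-∷ x ls = ≡.trans (≡.sym (map-∘ ls)) (map-∘ ls)

  module _ (K : ℕ) where
    private module ≡R = ≡.≡-Reasoning
    open Truncated K
    open CommutativeSemiring 𝔽₂[q]/q^K using (setoid; *-congʳ; *-assoc; reflexive)
    open import Relation.Binary.Reasoning.Setoid setoid

    map-sum-evenSets : ∀ s l → map sum (evenSets s l) ≋ P s l
    map-sum-evenSets s zero    = ≋-refl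
    map-sum-evenSets s (suc l) = begin
      map sum (D ++ map (e ∷_) D)           ≡⟨ map-++ sum D _ ⟩
      map sum D ++ map sum (map (e ∷_) D)   ≡⟨ ≡.cong (map sum D ++_) (map-sum-∷ e D) ⟩
      map sum D ++ map (e ℕ.+_) (map sum D)
        ≈⟨ ≋-exact (λ φ → ≡.trans (⟪⟫-++ (map sum D) _ φ) (≡.sym (≡.trans (⟪⟫-⊛ (0 ∷ e ∷ []) (map sum D) φ)
             (≡.cong (⟪ map sum D , φ ⟫ xor_) (≡.trans (xor-identityʳ _) (≡.sym (⟪⟫-map (e ℕ.+_) (map sum D) φ))))))) ⟩
      (0 ∷ e ∷ []) ⊛ map sum D              ≈⟨ ⊛-comm (0 ∷ e ∷ []) (map sum D) ⟩
      map sum D ⊛ (0 ∷ e ∷ [])              ≈⟨ *-congʳ (map-sum-evenSets s l) ⟩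
      P s l ⊛ (0 ∷ e ∷ [])                  ∎
      where
      D = evenSets s l
      e = 2 ℕ.* (s ℕ.+ suc l)

    -- The two compulsory copies of 1, 3, ..., 2k-1 add up to 2k², which gives Q^{k²}; each optional
    -- third copy gives a factor 1 + q^{2i-1}.
    map-sum-oddMultisets : ∀ k → map sum (oddMultisets k) ≋ (Q (k ℕ.* k) ⊛ oddProduct k)
    map-sum-oddMultisets zero    = ≋-refl
    map-sum-oddMultisets (suc k) = begin
      map sum (map (λ o → x ∷ x ∷ o) L)
        ≡⟨ ≡.trans (≡.sym (map-∘ L)) (≡.trans (Data.List.Properties.map-cong (λ o → ≡.sym (ℕₚ.+-assoc x x (sum o))) L) (map-∘ L)) ⟩
      map ((x ℕ.+ x) ℕ.+_) (map sum L)
        ≡⟨ ≡.cong (map _) (≡.trans (map-++ sum (oddMultisets k) _) (≡.cong (map sum (oddMultisets k) ++_) (map-sum-∷ x (oddMultisets k)))) ⟩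
      map ((x ℕ.+ x) ℕ.+_) (O ++ map (x ℕ.+_) O)
        ≈⟨ ≋-exact expand ⟩
      (x ℕ.+ x ∷ []) ⊛ ((0 ∷ x ∷ []) ⊛ O)
        ≈⟨ ⊛-cong (≋-refl {x ℕ.+ x ∷ []}) (⊛-cong (≋-refl {0 ∷ x ∷ []}) (map-sum-oddMultisets k)) ⟩
      (x ℕ.+ x ∷ []) ⊛ ((0 ∷ x ∷ []) ⊛ (Q (k ℕ.* k) ⊛ oddProduct k))
        ≈⟨ ⊛-cong (≋-refl {x ℕ.+ x ∷ []}) (≋-trans (⊛-comm (0 ∷ x ∷ []) (Q (k ℕ.* k) ⊛ oddProduct k)) (*-assoc (Q (k ℕ.* k)) (oddProduct k) _)) ⟩
      (x ℕ.+ x ∷ []) ⊛ (Q (k ℕ.* k) ⊛ (oddProduct k ⊛ (0 ∷ x ∷ [])))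
        ≈⟨ ≋-sym (*-assoc (x ℕ.+ x ∷ []) (Q (k ℕ.* k)) (oddProduct k ⊛ (0 ∷ x ∷ []))) ⟩
      (x ℕ.+ x ℕ.+ 2 ℕ.* (k ℕ.* k) ∷ []) ⊛ (oddProduct k ⊛ (0 ∷ x ∷ []))
        ≡⟨ ≡.cong (λ e → (e ∷ []) ⊛ (oddProduct k ⊛ (0 ∷ x ∷ []))) (lem k) ⟩
      Q (suc k ℕ.* suc k) ⊛ oddProduct (suc k) ∎
      where
      x = suc (2 ℕ.* k)
      L = oddMultisets k ++ map (x ∷_) (oddMultisets k)
      O = map sum (oddMultisets k)
      expand : ∀ φ → ⟪ map ((x ℕ.+ x) ℕ.+_) (O ++ map (x ℕ.+_) O) , φ ⟫ ≡ ⟪ (x ℕ.+ x ∷ []) ⊛ ((0 ∷ x ∷ []) ⊛ O) , φ ⟫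
      expand φ = ≡R.begin
        ⟪ map ((x ℕ.+ x) ℕ.+_) (O ++ map (x ℕ.+_) O) , φ ⟫  ≡R.≡⟨ ⟪⟫-map _ (O ++ map (x ℕ.+_) O) φ ⟩
        ⟪ O ++ map (x ℕ.+_) O , ψ ⟫                         ≡R.≡⟨ ⟪⟫-++ O _ ψ ⟩
        ⟪ O , ψ ⟫ xor ⟪ map (x ℕ.+_) O , ψ ⟫
          ≡R.≡⟨ ≡.cong (⟪ O , ψ ⟫ xor_) (≡.trans (⟪⟫-map (x ℕ.+_) O ψ) (≡.sym (xor-identityʳ _))) ⟩
        ⟪ 0 ∷ x ∷ [] , (λ y → ⟪ O , (λ w → ψ (y ℕ.+ w)) ⟫) ⟫ ≡R.≡⟨ ⟪⟫-⊛ (0 ∷ x ∷ []) O ψ ⟨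
        ⟪ (0 ∷ x ∷ []) ⊛ O , ψ ⟫                            ≡R.≡⟨ xor-identityʳ _ ⟨
        ⟪ (0 ∷ x ∷ []) ⊛ O , ψ ⟫ xor false                  ≡R.≡⟨ ⟪⟫-⊛ (x ℕ.+ x ∷ []) ((0 ∷ x ∷ []) ⊛ O) φ ⟨
        ⟪ (x ℕ.+ x ∷ []) ⊛ ((0 ∷ x ∷ []) ⊛ O) , φ ⟫         ≡R.∎
        where
        ψ : ℕ → Bool
        ψ y = φ (x ℕ.+ x ℕ.+ y)
      lem : ∀ k → suc (2 ℕ.* k) ℕ.+ suc (2 ℕ.* k) ℕ.+ 2 ℕ.* (k ℕ.* k) ≡ 2 ℕ.* (suc k ℕ.* suc k)
      lem = solve-∀

    map-sum-cartesianProduct : ∀ A B → map sum (map (uncurry _++_) (cartesianProduct A B)) ≡ map sum A ⊛ map sum B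
    map-sum-cartesianProduct []      B = ≡.refl
    map-sum-cartesianProduct (a ∷ A) B = ≡R.begin
      map sum (map (uncurry _++_) (map (a ,_) B ++ cartesianProduct A B))
        ≡R.≡⟨ ≡.trans (≡.cong (map sum) (map-++ (uncurry _++_) (map (a ,_) B) _)) (map-++ sum (map (uncurry _++_) (map (a ,_) B)) _) ⟩
      map sum (map (uncurry _++_) (map (a ,_) B)) ++ map sum (map (uncurry _++_) (cartesianProduct A B))
        ≡R.≡⟨ ≡.cong₂ _++_ (≡.trans (≡.cong (map sum) (≡.sym (map-∘ B))) (≡.trans (≡.sym (map-∘ B))
              (≡.trans (Data.List.Properties.map-cong (sum-++ a) B) (map-∘ B)))) (map-sum-cartesianProduct A B) ⟩
      map sum (a ∷ A) ⊛ map sum B ≡R.∎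

    map-sum-concat : ∀ n (F : ℕ → List (List ℕ)) f → (∀ i → map sum (F i) ≋ f i) →
      map sum (concat (applyUpTo F n)) ≋ ∑ n f
    map-sum-concat zero    F f h = ≋-refl
    map-sum-concat (suc n) F f h = ≋-trans (reflexive (map-++ sum (F 0) _))
      (++-cong (h 0) (map-sum-concat n _ _ (λ i → h (suc i))))

    map-sum-candidates : ∀ N → K ≤ N → map sum (candidates N) ≋
      (0 ∷ ∑ N (λ r → exponent⁺ r ∷ exponent⁻ r ∷ []))
    map-sum-candidates N K≤N = ≋-trans
      (map-sum-concat (suc N) (block N) (λ k → Q (k ℕ.* k) ⊛ (oddProduct k ⊛ tail q^-nilpotent N K≤N k)) λ k → begin
        map sum (block N k) ≡⟨ map-sum-cartesianProduct (evenSets (k ℕ.+ k) ((N ∸ k) ℕ.+ (N ∸ k))) (oddMultisets k) ⟩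
        map sum (evenSets (k ℕ.+ k) ((N ∸ k) ℕ.+ (N ∸ k))) ⊛ map sum (oddMultisets k)
          ≈⟨ ⊛-cong (map-sum-evenSets (k ℕ.+ k) ((N ∸ k) ℕ.+ (N ∸ k))) (map-sum-oddMultisets k) ⟩
        P (k ℕ.+ k) ((N ∸ k) ℕ.+ (N ∸ k)) ⊛ (Q (k ℕ.* k) ⊛ oddProduct k)
          ≈⟨ ⊛-comm (P (k ℕ.+ k) ((N ∸ k) ℕ.+ (N ∸ k))) (Q (k ℕ.* k) ⊛ oddProduct k) ⟩
        Q (k ℕ.* k) ⊛ oddProduct k ⊛ P (k ℕ.+ k) ((N ∸ k) ℕ.+ (N ∸ k))     ≈⟨ *-assoc (Q (k ℕ.* k)) (oddProduct k) _ ⟩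
        Q (k ℕ.* k) ⊛ (oddProduct k ⊛ P (k ℕ.+ k) ((N ∸ k) ℕ.+ (N ∸ k)))   ∎)
      (rogers-selberg q^-nilpotent N K≤N)

open GeneratingFunctions

-- The candidates of sum n are the partitions counted by c₅.

module Enumeration where

  open import Defs
  open import Data.Bool using (Bool; true; false; _∧_; _∨_; not; T)
  open import Data.Bool.Properties using (T-∧; T-∨; T-≡; T-not-≡)
  open import Data.Bool.ListAction using (all; any)
  open import Data.Empty using (⊥-elim)
  open import Data.List using (List; []; _∷_; _++_; map; foldr; concatMap; applyUpTo; upTo; length; filterᵇ; cartesianProduct; cartesianProductWith)
  import Data.List.Properties as Listₚ
  open import Data.List.Membership.Propositional using (_∈_)
  open import Data.List.Membership.Propositional.Properties
  open import Data.List.Relation.Unary.All as All using (All; []; _∷_)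
  import Data.List.Relation.Unary.All.Properties as Allₚ
  open import Data.List.Relation.Unary.AllPairs as AllPairs using (AllPairs; []; _∷_)
  import Data.List.Relation.Unary.AllPairs.Properties as AllPairsₚ
  open import Data.List.Relation.Unary.Any using (here; there)
  import Data.List.Relation.Unary.Any.Properties as Anyₚ
  open import Data.List.Relation.Unary.Unique.Propositional using (Unique)
  import Data.List.Relation.Unary.Unique.Propositional.Properties as Uniqueₚ
  open import Data.List.Relation.Binary.Disjoint.Propositional using (Disjoint)
  open import Data.List.Relation.Binary.Permutation.Propositional.Properties using (↭-length)
  open import Data.List.Relation.Binary.BagAndSetEquality using (∼bag⇒↭)
  open import Data.List.Membership.Propositional.Properties.WithK using (unique∧set⇒bag)
  open import Data.Nat using (ℕ; zero; suc; _+_; _*_; _∸_; _⊔_; _/_; _%_; _≤_; _<_; _≥_; _>_; z≤n; s≤s; _≡ᵇ_; _≤ᵇ_; _≟_)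
  open import Data.Nat.DivMod using (m≡m%n+[m/n]*n; m%n<n; m*n%n≡0; [m+kn]%n≡m%n; m*n/n≡m)
  open import Data.Nat.ListAction using (sum)
  open import Data.Nat.Properties hiding (_≟_)
  open import Data.Nat.Tactic.RingSolver using (solve-∀)
  open import Data.Product using (∃; ∃₂; _×_; _,_; proj₁; proj₂; uncurry)
  open import Data.Sum using (inj₁; inj₂)
  open import Data.Unit using (tt)
  open import Function using (_∘_; Equivalence; mk⇔)
  open import Relation.Binary.PropositionalEquality
  open import Relation.Nullary using (¬_; yes; no; contradiction; T?)

  open Equivalence using (to; from)

  even⇒2* : ∀ x → T (isEven x) → ∃ λ m → x ≡ 2 * m
  even⇒2* x e = x / 2 , trans (m≡m%n+[m/n]*n x 2)
    (cong₂ _+_ (≡ᵇ⇒≡ (x % 2) 0 e) (*-comm (x / 2) 2))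

  2*-even : ∀ m → T (isEven (2 * m))
  2*-even m = ≡⇒≡ᵇ _ 0 (trans (cong (_% 2) (*-comm 2 m)) (m*n%n≡0 m 2))

  1+2*-odd : ∀ m → T (isOdd (suc (2 * m)))
  1+2*-odd m = from T-not-≡ (cong (_≡ᵇ 0) (trans (cong (λ k → suc k % 2) (*-comm 2 m)) ([m+kn]%n≡m%n 1 m 2)))

  odd⇒1+2* : ∀ x → T (isOdd x) → ∃ λ m → x ≡ suc (2 * m)
  odd⇒1+2* x o with x % 2 in eq | m%n<n x 2
  ... | zero        | _ = ⊥-elim o
  ... | suc zero    | _ = x / 2 , trans (m≡m%n+[m/n]*n x 2) (cong₂ _+_ eq (*-comm (x / 2) 2))
  ... | suc (suc _) | s≤s (s≤s ())

  even-not-odd : ∀ x → T (isEven x) → ¬ T (isOdd x)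
  even-not-odd x e o with isEven x
  ... | true = o

  odd-not-even : ∀ x → T (isOdd x) → ¬ T (isEven x)
  odd-not-even x o e = even-not-odd x e o

  odd-positive : ∀ {x} → T (isOdd x) → 1 ≤ x
  odd-positive {suc x} _ = s≤s z≤n

  2*-suc : ∀ m → 2 * suc m ≡ suc (suc (2 * m))
  2*-suc = solve-∀

  even-below : ∀ {x t} → T (isEven x) → x < 2 * suc t → x ≤ 2 * t
  even-below {x} {t} e x< with even⇒2* x e
  ... | m , refl = *-monoʳ-≤ 2 (≤-pred (*-cancelˡ-< 2 m (suc t) x<))

  odd-below : ∀ {x k} → T (isOdd x) → x < 2 * suc k → x ≢ suc (2 * k) → x < 2 * k
  odd-below {x} {k} o x< x≢ with odd⇒1+2* x o
  ... | m , refl = subst (_≤ 2 * k) (2*-suc m) (*-monoʳ-≤ 2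
    (≤∧≢⇒< (≤-pred (*-cancelˡ-< 2 m (suc k) (<-trans (n<1+n _) x<))) (λ m≡k → x≢ (cong (λ i → suc (2 * i)) m≡k))))

  1+2*-injective : ∀ {i k} → suc (2 * i) ≡ suc (2 * k) → i ≡ k
  1+2*-injective eq = *-cancelˡ-≡ _ _ 2 (suc-injective eq)

  count-here : ∀ x ys → count x (x ∷ ys) ≡ suc (count x ys)
  count-here x ys rewrite to T-≡ (≡⇒≡ᵇ x x refl) = refl

  count-there : ∀ {x y} ys → y ≢ x → count x (y ∷ ys) ≡ count x ys
  count-there {x} {y} ys y≢x with y ≡ᵇ x in eq
  ... | true  = contradiction (≡ᵇ⇒≡ y x (from T-≡ eq)) y≢x
  ... | false = refl

  count-none : ∀ {x ys} → All (_≢ x) ys → count x ys ≡ 0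
  count-none []                  = refl
  count-none {ys = _ ∷ ys} (y≢x ∷ ys≢x) = trans (count-there ys y≢x) (count-none ys≢x)

  count≡0⇒none : ∀ x ys → count x ys ≡ 0 → All (_≢ x) ys
  count≡0⇒none x []       _ = []
  count≡0⇒none x (y ∷ ys) c≡0 with y ≟ x
  ... | yes refl = contradiction (trans (sym c≡0) (count-here x ys)) λ ()
  ... | no  y≢x  = y≢x ∷ count≡0⇒none x ys (trans (sym (count-there ys y≢x)) c≡0)

  count-++-none : ∀ {x} ys zs → All (_≢ x) ys → count x (ys ++ zs) ≡ count x zs
  count-++-none []       zs []           = refl
  count-++-none (y ∷ ys) zs (y≢x ∷ ys≢x) = trans (count-there (ys ++ zs) y≢x) (count-++-none ys zs ys≢x)

  data TwoOrThree : ℕ → Set where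
    two   : TwoOrThree 2
    three : TwoOrThree 3

  twoOrThree⁺ : ∀ c → T ((2 ≤ᵇ c) ∧ (c ≤ᵇ 3)) → TwoOrThree c
  twoOrThree⁺ 2 _ = two
  twoOrThree⁺ 3 _ = three

  twoOrThree⁻ : ∀ {c} → TwoOrThree c → T ((2 ≤ᵇ c) ∧ (c ≤ᵇ 3))
  twoOrThree⁻ two   = tt
  twoOrThree⁻ three = tt

  nonInc⇒sorted : ∀ p → T (nonIncᵇ p) → AllPairs _≥_ p
  nonInc⇒sorted []           _ = []
  nonInc⇒sorted (x ∷ [])     _ = [] ∷ []
  nonInc⇒sorted (x ∷ y ∷ ys) h with proj₁ (to (T-∧ {y ≤ᵇ x}) h) | nonInc⇒sorted (y ∷ ys) (proj₂ (to (T-∧ {y ≤ᵇ x}) h))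
  ... | y≤x | ys≤y ∷ sorted = (≤ᵇ⇒≤ y x y≤x ∷ All.map (λ z≤y → ≤-trans z≤y (≤ᵇ⇒≤ y x y≤x)) ys≤y) ∷ ys≤y ∷ sorted

  sorted⇒nonInc : ∀ {p} → AllPairs _≥_ p → T (nonIncᵇ p)
  sorted⇒nonInc []                             = tt
  sorted⇒nonInc ([] ∷ [])                      = tt
  sorted⇒nonInc ((y≤x ∷ _) ∷ sorted@(_ ∷ _))   = from T-∧ (≤⇒≤ᵇ y≤x , sorted⇒nonInc sorted)

  T-not⇒¬T : ∀ {b} → T (not b) → ¬ T b
  T-not⇒¬T {false} _ ()

  ¬T⇒T-not : ∀ {b} → ¬ T b → T (not b)
  ¬T⇒T-not {false} _  = tt
  ¬T⇒T-not {true}  ¬t = ¬t tt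

  distinct⇒unique : ∀ p → T (distinctᵇ p) → Unique p
  distinct⇒unique []       _ = []
  distinct⇒unique (x ∷ xs) h with to (T-∧ {not (any (_≡ᵇ x) xs)}) h
  ... | x∉xs , rest = All.tabulate (λ { {y} y∈xs refl → T-not⇒¬T x∉xs
      (Anyₚ.any⁺ (_≡ᵇ x) (Data.List.Relation.Unary.Any.map (λ { refl → ≡⇒≡ᵇ x x refl }) y∈xs)) })
    ∷ distinct⇒unique xs rest

  decreasing⇒distinct : ∀ {p} → AllPairs _>_ p → T (distinctᵇ p)
  decreasing⇒distinct []                      = tt
  decreasing⇒distinct {x ∷ xs} (xs<x ∷ rest) = from T-∧
    ( ¬T⇒T-not (λ t → Allₚ.All¬⇒¬Any (All.map (λ y<x y≡ᵇx → <⇒≢ y<x (≡ᵇ⇒≡ _ x y≡ᵇx)) xs<x) (Anyₚ.any⁻ (_≡ᵇ x) xs t))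
    , decreasing⇒distinct rest)

  max-sorted : ∀ {x xs} → All (_≤ x) xs → foldr _⊔_ 0 (x ∷ xs) ≡ x
  max-sorted {x} xs≤x = m≥n⇒m⊔n≡m (bound xs≤x)
    where
    bound : ∀ {xs} → All (_≤ x) xs → foldr _⊔_ 0 xs ≤ x
    bound []           = z≤n
    bound (y≤x ∷ ys≤x) = ⊔-lub y≤x (bound ys≤x)

  EvenIn : ℕ → ℕ → ℕ → Set
  EvenIn s l e = T (isEven e) × 2 * s < e × e ≤ 2 * (s + l)

  -- Either the head is the largest admissible value 2(s+l+1), or the head, being even, is at most
  -- 2(s+l) and bounds all the rest.
  evenSets⁺ : ∀ s l {ev} → AllPairs _>_ ev → All (EvenIn s l) ev → ev ∈ evenSets s l
  evenSets⁺ s zero    []       []      = here refl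
  evenSets⁺ s zero    (_ ∷ _)  ((_ , s<e , e≤s) ∷ _) =
    contradiction (≤-trans s<e (≤-trans e≤s (≤-reflexive (cong (2 *_) (+-identityʳ s))))) (<-irrefl refl)
  evenSets⁺ s (suc l) []       []      = ∈-++⁺ˡ (evenSets⁺ s l [] [])
  evenSets⁺ s (suc l) {e ∷ es} (es<e ∷ dec) ((even , s<e , e≤) ∷ rest) with e ≟ 2 * (s + suc l)
  ... | yes refl = ∈-++⁺ʳ (evenSets s l) (∈-map⁺ _ (evenSets⁺ s l dec (All.zipWith shrink (es<e , rest))))
    where
    shrink : ∀ {x} → x < 2 * (s + suc l) × EvenIn s (suc l) x → EvenIn s l x
    shrink {x} (x<e , even , s<x , _) = even , s<x , even-below even (subst (λ t → x < 2 * t) (+-suc s l) x<e)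
  ... | no  e≢ = ∈-++⁺ˡ (evenSets⁺ s l (es<e ∷ dec) ((even , s<e , e≤′) ∷ All.zipWith
      (λ { (x<e , even , s<x , _) → even , s<x , ≤-trans (<⇒≤ x<e) e≤′ }) (es<e , rest)))
    where
    e≤′ : e ≤ 2 * (s + l)
    e≤′ = even-below even (subst (λ t → e < 2 * t) (+-suc s l) (≤∧≢⇒< e≤ e≢))

  evenSets⁻ : ∀ s l {ev} → ev ∈ evenSets s l → AllPairs _>_ ev × All (EvenIn s l) ev
  evenSets⁻ s zero    (here refl) = [] , []
  evenSets⁻ s (suc l) ev∈ with ∈-++⁻ (evenSets s l) ev∈
  ... | inj₁ ev∈′ with evenSets⁻ s l ev∈′
  ...   | dec , evens = dec , All.map (λ { (even , s<e , e≤) → even , s<e , ≤-trans e≤ (*-monoʳ-≤ 2 (+-monoʳ-≤ s (n≤1+n l))) }) evens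
  evenSets⁻ s (suc l) ev∈ | inj₂ ev∈′ with ∈-map⁻ _ ev∈′
  ... | es , es∈ , refl with evenSets⁻ s l es∈
  ...   | dec , evens = All.map (λ { (_ , _ , e≤) → ≤-<-trans e≤ (*-monoʳ-< 2 (+-monoʳ-< s (n<1+n l))) }) evens ∷ dec
    , (2*-even (s + suc l) , *-monoʳ-< 2 (m<m+n s (s≤s z≤n)) , ≤-refl)
    ∷ All.map (λ { (even , s<e , e≤) → even , s<e , ≤-trans e≤ (*-monoʳ-≤ 2 (+-monoʳ-≤ s (n≤1+n l))) }) evens

  -- Injectivity is asked only on members: concatenation is not injective on arbitrary pairs of
  -- lists, but it is on pairs of an even and an odd list.
  unique-map : ∀ {A B : Set} {f : A → B} {xs} → (∀ {x y} → x ∈ xs → y ∈ xs → f x ≡ f y → x ≡ y) →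
    Unique xs → Unique (map f xs)
  unique-map inj []         = []
  unique-map inj (x∉ ∷ xs!) = Allₚ.map⁺ (All.tabulate (λ y∈ eq → All.lookup x∉ y∈ (inj (here refl) (there y∈) eq)))
    ∷ unique-map (λ x∈ y∈ → inj (there x∈) (there y∈)) xs!

  evenSets-unique : ∀ s l → Unique (evenSets s l)
  evenSets-unique s zero    = [] ∷ []
  evenSets-unique s (suc l) = Uniqueₚ.++⁺ (evenSets-unique s l)
    (Uniqueₚ.map⁺ Listₚ.∷-injectiveʳ (evenSets-unique s l)) disjoint
    where
    disjoint : Disjoint (evenSets s l) (map (2 * (s + suc l) ∷_) (evenSets s l))
    disjoint (ev∈ , ev∈′) with ∈-map⁻ _ ev∈′
    ... | _ , _ , refl with evenSets⁻ s l ev∈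
    ...   | _ , (_ , _ , e≤) ∷ _ = <⇒≱ (*-monoʳ-< 2 (+-monoʳ-< s (n<1+n l))) e≤

  -- Gap-free odd parts.

  OddBelow : ℕ → ℕ → Set
  OddBelow k o = T (isOdd o) × o < 2 * k

  record IsOddMultiset (k : ℕ) (od : List ℕ) : Set where
    field
      sorted : AllPairs _≥_ od
      odds   : All (OddBelow k) od
      counts : ∀ i → i < k → TwoOrThree (count (suc (2 * i)) od)
  open IsOddMultiset

  module _ {k : ℕ} where

    private x = suc (2 * k)

    private
      count-tail : ∀ {i} ys → i < k → count (suc (2 * i)) (x ∷ ys) ≡ count (suc (2 * i)) ys
      count-tail {i} ys i<k = count-there {suc (2 * i)} ys (λ eq → <⇒≢ i<k (sym (1+2*-injective eq)))

    -- If the head were not 2k + 1 it would be smaller, and by the ordering 2k + 1 could not occur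
    -- at all, contrary to its positive count.
    uncons-max : ∀ {od c} → AllPairs _≥_ od → All (OddBelow (suc k)) od → count x od ≡ suc c →
      ∃ λ od′ → od ≡ x ∷ od′ × count x od′ ≡ c
    uncons-max {y ∷ od} (od≤y ∷ _) ((odd , y<) ∷ _) c≡ with y ≟ x
    ... | yes refl = od , refl , suc-injective (trans (sym (count-here x od)) c≡)
    ... | no  y≢x  = contradiction (trans (sym c≡) (count-none (y≢x ∷ All.map (λ z≤y → <⇒≢ (≤-<-trans z≤y y<x)) od≤y))) λ ()
      where
      y<x : y < x
      y<x = <-trans (odd-below {y} {k} odd y< y≢x) (n<1+n _)

    restrict : ∀ {od} → AllPairs _≥_ od → All (OddBelow (suc k)) od → count x od ≡ 0 →
      (∀ i → i < k → TwoOrThree (count (suc (2 * i)) od)) → IsOddMultiset k od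
    restrict s os c≡0 cs = record
      { sorted = s
      ; odds   = All.zipWith (λ { {y} ((odd , y<) , y≢x) → odd , odd-below {y} {k} odd y< y≢x }) (os , count≡0⇒none x _ c≡0)
      ; counts = cs }

    -- The count of 2k + 1, which is 2 or 3, says how many heads to strip; afterwards it is 0 and
    -- the remaining parts lie below 2k.
    uncons-odd : ∀ {od} → IsOddMultiset (suc k) od → ∃ λ o →
      IsOddMultiset k o × ((od ≡ x ∷ x ∷ o) Data.Sum.⊎ (od ≡ x ∷ x ∷ x ∷ o))
    uncons-odd {od} h with count x od in c≡ | counts h k (n<1+n k)
    ... | 2 | two with uncons-max (sorted h) (odds h) c≡
    ...   | _ , refl , c₁≡ with sorted h | odds h
    ...     | _ ∷ s₁ | _ ∷ o₁ with uncons-max s₁ o₁ c₁≡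
    ...       | o , refl , c₂≡ with s₁ | o₁
    ...         | _ ∷ s₂ | _ ∷ o₂ = o , restrict s₂ o₂ c₂≡ (λ i i<k → subst TwoOrThree
        (trans (count-tail (x ∷ o) i<k) (count-tail o i<k)) (counts h i (m<n⇒m<1+n i<k))) , inj₁ refl
    uncons-odd {od} h | 3 | three with uncons-max (sorted h) (odds h) c≡
    ...   | _ , refl , c₁≡ with sorted h | odds h
    ...     | _ ∷ s₁ | _ ∷ o₁ with uncons-max s₁ o₁ c₁≡
    ...       | _ , refl , c₂≡ with s₁ | o₁
    ...         | _ ∷ s₂ | _ ∷ o₂ with uncons-max s₂ o₂ c₂≡
    ...           | o , refl , c₃≡ with s₂ | o₂
    ...             | _ ∷ s₃ | _ ∷ o₃ = o , restrict s₃ o₃ c₃≡ (λ i i<k → subst TwoOrThree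
        (trans (count-tail (x ∷ x ∷ o) i<k) (trans (count-tail (x ∷ o) i<k) (count-tail o i<k))) (counts h i (m<n⇒m<1+n i<k))) , inj₂ refl

    widen : ∀ {o} → All (OddBelow k) o → All (OddBelow (suc k)) o
    widen = All.map (λ { (odd , o<) → odd , ≤-trans o< (*-monoʳ-≤ 2 (n≤1+n k)) })

    x-odd : OddBelow (suc k) x
    x-odd = 1+2*-odd k , ≤-reflexive (sym (2*-suc k))

    below-x : ∀ {o} → All (OddBelow k) o → All (_≤ x) o
    below-x = All.map (λ { (_ , o<) → m≤n⇒m≤1+n (<⇒≤ o<) })

    count-x : ∀ {o} → IsOddMultiset k o → count x o ≡ 0
    count-x h = count-none (All.map (λ { (_ , o<) → <⇒≢ (m<n⇒m<1+n o<) }) (odds h))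

    cons₂-odd : ∀ {o} → IsOddMultiset k o → IsOddMultiset (suc k) (x ∷ x ∷ o)
    cons₂-odd {o} h = record
      { sorted = (≤-refl ∷ below-x (odds h)) ∷ below-x (odds h) ∷ sorted h
      ; odds   = x-odd ∷ x-odd ∷ widen (odds h)
      ; counts = cs }
      where
      cs : ∀ i → i < suc k → TwoOrThree (count (suc (2 * i)) (x ∷ x ∷ o))
      cs i i<1+k with i ≟ k
      ... | yes refl = subst TwoOrThree (sym (trans (count-here x (x ∷ o)) (cong suc (trans (count-here x o) (cong suc (count-x h)))))) two
      ... | no  i≢k  = subst TwoOrThree (sym (trans (count-tail (x ∷ o) i<k) (count-tail o i<k))) (counts h i i<k)
        where i<k = ≤∧≢⇒< (≤-pred i<1+k) i≢k

    cons₃-odd : ∀ {o} → IsOddMultiset k o → IsOddMultiset (suc k) (x ∷ x ∷ x ∷ o)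
    cons₃-odd {o} h = record
      { sorted = (≤-refl ∷ ≤-refl ∷ below-x (odds h)) ∷ sorted (cons₂-odd h)
      ; odds   = x-odd ∷ odds (cons₂-odd h)
      ; counts = cs }
      where
      cs : ∀ i → i < suc k → TwoOrThree (count (suc (2 * i)) (x ∷ x ∷ x ∷ o))
      cs i i<1+k with i ≟ k
      ... | yes refl = subst TwoOrThree (sym (trans (count-here x (x ∷ x ∷ o)) (cong suc (trans (count-here x (x ∷ o)) (cong suc
          (trans (count-here x o) (cong suc (count-x h)))))))) three
      ... | no  i≢k  = subst TwoOrThree (sym (count-tail (x ∷ x ∷ o) i<k)) (counts (cons₂-odd h) i i<1+k)
        where i<k = ≤∧≢⇒< (≤-pred i<1+k) i≢k

  oddMultisets⁺ : ∀ k {od} → IsOddMultiset k od → od ∈ oddMultisets k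
  oddMultisets⁺ zero    {[]}    _ = here refl
  oddMultisets⁺ zero    {_ ∷ _} h with odds h
  ... | (_ , ()) ∷ _
  oddMultisets⁺ (suc k) h with uncons-odd h
  ... | o , h′ , inj₁ refl = ∈-map⁺ _ (∈-++⁺ˡ (oddMultisets⁺ k h′))
  ... | o , h′ , inj₂ refl = ∈-map⁺ _ (∈-++⁺ʳ (oddMultisets k) (∈-map⁺ _ (oddMultisets⁺ k h′)))

  oddMultisets⁻ : ∀ k {od} → od ∈ oddMultisets k → IsOddMultiset k od
  oddMultisets⁻ zero    (here refl) = record { sorted = [] ; odds = [] ; counts = λ _ () }
  oddMultisets⁻ (suc k) od∈ with ∈-map⁻ _ od∈
  ... | o , o∈ , refl with ∈-++⁻ (oddMultisets k) o∈
  ...   | inj₁ o∈ = cons₂-odd (oddMultisets⁻ k o∈)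
  ...   | inj₂ o∈ with ∈-map⁻ _ o∈
  ...     | _ , o∈ , refl = cons₃-odd (oddMultisets⁻ k o∈)

  oddMultisets-head : ∀ k {od} → od ∈ oddMultisets (suc k) → ∃ λ t → od ≡ suc (2 * k) ∷ t
  oddMultisets-head k od∈ with ∈-map⁻ _ od∈
  ... | _ , _ , refl = _ , refl

  oddMultisets-unique : ∀ k → Unique (oddMultisets k)
  oddMultisets-unique zero    = [] ∷ []
  oddMultisets-unique (suc k) = Uniqueₚ.map⁺ (λ eq → Listₚ.∷-injectiveʳ (Listₚ.∷-injectiveʳ eq))
    (Uniqueₚ.++⁺ (oddMultisets-unique k) (Uniqueₚ.map⁺ Listₚ.∷-injectiveʳ (oddMultisets-unique k)) disjoint)
    where
    disjoint : Disjoint (oddMultisets k) (map (suc (2 * k) ∷_) (oddMultisets k))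
    disjoint (o∈ , o∈′) with ∈-map⁻ _ o∈′
    ... | _ , _ , refl with odds (oddMultisets⁻ k o∈)
    ...   | (_ , x<) ∷ _ = <⇒≱ x< (n≤1+n _)

  -- The largest part of the second multiset is too big for the first.
  oddMultisets-disjoint : ∀ {k k′} → k < k′ → Disjoint (oddMultisets k) (oddMultisets k′)
  oddMultisets-disjoint {k} {suc k′} (s≤s k≤k′) (o∈ , o∈′) with oddMultisets-head k′ o∈′
  ... | _ , refl with odds (oddMultisets⁻ k o∈)
  ...   | (_ , x<) ∷ _ = <⇒≱ x< (≤-trans (*-monoʳ-≤ 2 k≤k′) (n≤1+n _))

  -- Blocks as concatenations, and the conditions (a) and (b).

  evenRange : ℕ → ℕ → List (List ℕ)
  evenRange N k = evenSets (k + k) ((N ∸ k) + (N ∸ k))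

  block⁻ : ∀ N k {p} → p ∈ block N k → ∃₂ λ ev od → ev ∈ evenRange N k × od ∈ oddMultisets k × p ≡ ev ++ od
  block⁻ N k p∈ with ∈-map⁻ _ p∈
  ... | (ev , od) , eo∈ , refl with ∈-cartesianProduct⁻ (evenRange N k) (oddMultisets k) eo∈
  ...   | ev∈ , od∈ = ev , od , ev∈ , od∈ , refl

  block⁺ : ∀ N k {ev od} → ev ∈ evenRange N k → od ∈ oddMultisets k → ev ++ od ∈ block N k
  block⁺ N k ev∈ od∈ = ∈-map⁺ _ (∈-cartesianProduct⁺ ev∈ od∈)

  module _ {ev od : List ℕ} (evens : All (T ∘ isEven) ev) (odds : All (T ∘ isOdd) od) where

    -- With `odds-++`, this recovers both halves from the concatenation, which is why no block has
    -- repetitions and different blocks are disjoint.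
    evens-++ : filterᵇ isEven (ev ++ od) ≡ ev
    evens-++ = trans (Listₚ.filter-++ (T? ∘ isEven) ev od)
      (trans (cong₂ _++_ (Listₚ.filter-all (T? ∘ isEven) evens) (Listₚ.filter-none (T? ∘ isEven) (All.map (λ {x} → odd-not-even x) odds))) (Listₚ.++-identityʳ ev))

    odds-++ : filterᵇ isOdd (ev ++ od) ≡ od
    odds-++ = trans (Listₚ.filter-++ (T? ∘ isOdd) ev od)
      (cong₂ _++_ (Listₚ.filter-none (T? ∘ isOdd) (All.map (λ {x} → even-not-odd x) evens)) (Listₚ.filter-all (T? ∘ isOdd) odds))

  evenRange-even : ∀ N k {ev} → ev ∈ evenRange N k → All (T ∘ isEven) ev
  evenRange-even N k ev∈ = All.map proj₁ (proj₂ (evenSets⁻ (k + k) ((N ∸ k) + (N ∸ k)) ev∈))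

  oddMultisets-odd : ∀ k {od} → od ∈ oddMultisets k → All (T ∘ isOdd) od
  oddMultisets-odd k od∈ = All.map proj₁ (odds (oddMultisets⁻ k od∈))

  block-unique : ∀ N k → Unique (block N k)
  block-unique N k = unique-map injective
    (Uniqueₚ.cartesianProduct⁺ (evenSets-unique (k + k) ((N ∸ k) + (N ∸ k))) (oddMultisets-unique k))
    where
    injective : ∀ {x y} → x ∈ cartesianProduct (evenRange N k) (oddMultisets k) →
      y ∈ cartesianProduct (evenRange N k) (oddMultisets k) → uncurry _++_ x ≡ uncurry _++_ y → x ≡ y
    injective {ev , od} {ev′ , od′} x∈ y∈ eq
      with ∈-cartesianProduct⁻ (evenRange N k) (oddMultisets k) x∈ | ∈-cartesianProduct⁻ (evenRange N k) (oddMultisets k) y∈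
    ... | ev∈ , od∈ | ev′∈ , od′∈ = cong₂ _,_
      (trans (sym (evens-++ e o)) (trans (cong (filterᵇ isEven) eq) (evens-++ e′ o′)))
      (trans (sym (odds-++ e o)) (trans (cong (filterᵇ isOdd) eq) (odds-++ e′ o′)))
      where
      e  = evenRange-even N k ev∈
      o  = oddMultisets-odd k od∈
      e′ = evenRange-even N k ev′∈
      o′ = oddMultisets-odd k od′∈

  candidates-unique : ∀ N → Unique (candidates N)
  candidates-unique N = Uniqueₚ.concat⁺ (Allₚ.applyUpTo⁺₂ (block N) (suc N) (block-unique N))
    (AllPairsₚ.applyUpTo⁺₁ (block N) (suc N) (λ i<j _ → disjoint i<j))
    where
    disjoint : ∀ {i j} → i < j → Disjoint (block N i) (block N j)
    disjoint {i} {j} i<j (p∈ , p∈′) with block⁻ N i p∈ | block⁻ N j p∈′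
    ... | ev , od , ev∈ , od∈ , refl | ev′ , od′ , ev′∈ , od′∈ , eq = oddMultisets-disjoint i<j
      (od∈ , subst (_∈ oddMultisets j) (sym od≡) od′∈)
      where
      od≡ : od ≡ od′
      od≡ = trans (sym (odds-++ (evenRange-even N i ev∈) (oddMultisets-odd i od∈)))
        (trans (cong (filterᵇ isOdd) eq) (odds-++ (evenRange-even N j ev′∈) (oddMultisets-odd j od′∈)))

  candidates⁺ : ∀ N k {ev od} → k ≤ N → ev ∈ evenRange N k → od ∈ oddMultisets k → ev ++ od ∈ candidates N
  candidates⁺ N k k≤N ev∈ od∈ = ∈-concat⁺′ (block⁺ N k ev∈ od∈) (∈-applyUpTo⁺ (block N) (s≤s k≤N))

  candidates⁻ : ∀ N {p} → p ∈ candidates N → ∃ λ k → p ∈ block N k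
  candidates⁻ N p∈ with ∈-concat⁻′ (applyUpTo (block N) (suc N)) p∈
  ... | _ , p∈ , b∈ with ∈-applyUpTo⁻ (block N) b∈
  ...   | k , _ , refl = k , p∈

  -- The body of `condBᵇ` with the odd and even sublists as arguments, so that known lists can be
  -- substituted for the two filters; `condBᵇ p` is definitionally an instance.
  condB-parts : List ℕ → List ℕ → List ℕ → Bool
  condB-parts od ev p =
    let m = foldr _⊔_ 0 od
        k = (m + 1) / 2
    in  (1 ≤ᵇ length od)
      ∧ all (λ i → let c = count (2 * i ∸ 1) p in (2 ≤ᵇ c) ∧ (c ≤ᵇ 3)) (applyUpTo suc k)
      ∧ distinctᵇ ev
      ∧ all (λ e → (2 * m + 4) ≤ᵇ e) ev

  module _ {k : ℕ} where

    half : (suc (2 * k) + 1) / 2 ≡ suc k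
    half = trans (cong (_/ 2) (lem k)) (m*n/n≡m (suc k) 2)
      where
      lem : ∀ k → suc (2 * k) + 1 ≡ suc k * 2
      lem = solve-∀

    2*suc∸1 : ∀ i → 2 * suc i ∸ 1 ≡ suc (2 * i)
    2*suc∸1 i = +-suc i (i + 0)

    condB-parts⁻ : ∀ od ev p → foldr _⊔_ 0 od ≡ suc (2 * k) → T (condB-parts od ev p) →
      (∀ i → i < suc k → TwoOrThree (count (suc (2 * i)) p)) × Unique ev × All (2 * suc (2 * k) + 4 ≤_) ev
    condB-parts⁻ od ev p m≡ t with foldr _⊔_ 0 od
    condB-parts⁻ od ev p refl t | _ rewrite half
      with to (T-∧ {1 ≤ᵇ length od}) t
    ... | _ , t₁ with to (T-∧ {all (λ i → (2 ≤ᵇ count (2 * i ∸ 1) p) ∧ (count (2 * i ∸ 1) p ≤ᵇ 3)) (applyUpTo suc (suc k))}) t₁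
    ...   | counts , t₂ with to (T-∧ {distinctᵇ ev}) t₂
    ...     | dist , large =
      (λ i i<1+k → subst (λ x → TwoOrThree (count x p)) (2*suc∸1 i)
        (twoOrThree⁺ _ (Allₚ.applyUpTo⁻ suc (suc k) (Allₚ.all⁺ _ _ counts) i<1+k)))
      , distinct⇒unique ev dist
      , All.map (λ {e} → ≤ᵇ⇒≤ (2 * suc (2 * k) + 4) e) (Allₚ.all⁺ _ ev large)

    condB-parts⁺ : ∀ od ev p → foldr _⊔_ 0 od ≡ suc (2 * k) → 1 ≤ length od →
      (∀ i → i < suc k → TwoOrThree (count (suc (2 * i)) p)) → AllPairs _>_ ev → All (2 * suc (2 * k) + 4 ≤_) ev →
      T (condB-parts od ev p)
    condB-parts⁺ od ev p m≡ 1≤ counts dec large with foldr _⊔_ 0 od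
    condB-parts⁺ od ev p refl 1≤ counts dec large | _ rewrite half = from T-∧ (≤⇒≤ᵇ 1≤ , from (T-∧
      {all (λ i → (2 ≤ᵇ count (2 * i ∸ 1) p) ∧ (count (2 * i ∸ 1) p ≤ᵇ 3)) (applyUpTo suc (suc k))})
      ( Allₚ.all⁻ _ (Allₚ.applyUpTo⁺₁ suc (suc k) (λ {i} i<1+k →
          twoOrThree⁻ (subst (λ x → TwoOrThree (count x p)) (sym (2*suc∸1 i)) (counts i i<1+k))))
      , from T-∧ (decreasing⇒distinct dec , Allₚ.all⁻ _ (All.map ≤⇒≤ᵇ large))))

  -- If the head is odd, an even entry further on would have to exceed it by hypothesis and not
  -- exceed it by the ordering. Hence no even entry follows an odd one.
  sorted-split : ∀ p → AllPairs _≥_ p →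
    (∀ {e o} → e ∈ filterᵇ isEven p → o ∈ filterᵇ isOdd p → o < e) → p ≡ filterᵇ isEven p ++ filterᵇ isOdd p
  sorted-split []      _            _ = refl
  sorted-split (x ∷ p) (p≤x ∷ sorted) h with isEven x
  ... | true  = cong (x ∷_) (sorted-split p sorted (λ e∈ o∈ → h (there e∈) o∈))
  ... | false with filterᵇ isEven p in eq | sorted-split p sorted (λ e∈ o∈ → h e∈ (there o∈))
  ...   | []    | ih = cong (x ∷_) ih
  ...   | e ∷ _ | _  = contradiction (h (subst (e ∈_) (sym eq) (here refl)) (here refl))
    (≤⇒≯ (All.lookup p≤x (proj₁ (∈-filter⁻ (T? ∘ isEven) {xs = p} (subst (e ∈_) (sym eq) (here refl))))))

  condA⇒candidate : ∀ N {p} → AllPairs _≥_ p → All (1 ≤_) p → All (_≤ N) p → T (condAᵇ p) → p ∈ candidates N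
  condA⇒candidate N {p} sorted pos bound t with to (T-∧ {all isEven p}) t
  ... | even , dist = subst (_∈ candidates N) (Listₚ.++-identityʳ p)
    (candidates⁺ N 0 z≤n (evenSets⁺ 0 (N + N) decreasing evens) (here refl))
    where
    decreasing : AllPairs _>_ p
    decreasing = AllPairs.zipWith (λ { (y≤x , x≢y) → ≤∧≢⇒< y≤x (x≢y ∘ sym) }) (sorted , distinct⇒unique p dist)
    evens : All (EvenIn 0 (N + N)) p
    evens = All.zipWith (λ { (e , 1≤x , x≤N) → e , 1≤x , ≤-trans x≤N (≤-trans (m≤m+n N N) (m≤m+n (N + N) _)) })
      (Allₚ.all⁺ isEven p even , All.zip (pos , bound))

  -- The head 2k + 1 of the odd sublist is the largest odd part and fixes the block index k + 1. The
  -- even parts, being at least 2(2k+1) + 4, exceed all odd parts, so the ordering puts them in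
  -- front and p has the form of a concatenation.
  condB⇒candidate : ∀ N {p} → AllPairs _≥_ p → All (_≤ N) p → T (condBᵇ p) → p ∈ candidates N
  condB⇒candidate N {p} sorted-p bound t = go (filterᵇ isOdd p) refl
    where
    ev = filterᵇ isEven p

    go : ∀ od → filterᵇ isOdd p ≡ od → p ∈ candidates N
    go []       eq = ⊥-elim (subst (λ od → T (condB-parts od ev p)) eq t)
    go (o ∷ os) eq with odd⇒1+2* o (proj₂ (∈-filter⁻ (T? ∘ isOdd) {xs = p} (subst (o ∈_) (sym eq) (here refl))))
                      | subst (AllPairs _≥_) eq (AllPairsₚ.filter⁺ (T? ∘ isOdd) sorted-p)
    ... | k , refl | sorted-od@(os≤o ∷ _)
      with condB-parts⁻ {k} (o ∷ os) ev p (max-sorted os≤o) (subst (λ od → T (condB-parts od ev p)) eq t)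
    ...   | counts-p , ev! , large = subst (_∈ candidates N) (sym p≡)
      (candidates⁺ N K K≤N (evenSets⁺ (K + K) ((N ∸ K) + (N ∸ K)) decreasing evens) (oddMultisets⁺ K od-multiset))
      where
      K = suc k
      od = o ∷ os

      od≤o : All (_≤ o) od
      od≤o = ≤-refl ∷ os≤o

      odds-od : All (T ∘ isOdd) od
      odds-od = subst (All (T ∘ isOdd)) eq (Allₚ.all-filter (T? ∘ isOdd) p)

      o≤N : o ≤ N
      o≤N = All.lookup bound (proj₁ (∈-filter⁻ (T? ∘ isOdd) {xs = p} (subst (o ∈_) (sym eq) (here refl))))

      K≤N : K ≤ N
      K≤N = ≤-trans (s≤s (m≤m+n k _)) o≤N

      o<e : ∀ {e} → 2 * suc (2 * k) + 4 ≤ e → o < e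
      o<e large = ≤-trans (≤-trans (≤-reflexive (+-comm 1 o)) (+-mono-≤ (m≤m+n o _) (s≤s z≤n))) large

      p≡ : p ≡ ev ++ od
      p≡ = trans (sorted-split p sorted-p (λ e∈ o∈ →
        ≤-<-trans (All.lookup od≤o (subst (_ ∈_) eq o∈)) (o<e (All.lookup large e∈)))) (cong (ev ++_) eq)

      decreasing : AllPairs _>_ ev
      decreasing = AllPairs.zipWith (λ { (y≤x , x≢y) → ≤∧≢⇒< y≤x (x≢y ∘ sym) })
        (AllPairsₚ.filter⁺ (T? ∘ isEven) sorted-p , ev!)

      lem₁ : ∀ k → suc (2 * (suc k + suc k)) + 1 ≡ 2 * suc (2 * k) + 4
      lem₁ = solve-∀
      lem₂ : ∀ K d → K + d + (K + d) ≡ K + K + (d + d)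
      lem₂ = solve-∀

      evens : All (EvenIn (K + K) ((N ∸ K) + (N ∸ K))) ev
      evens = All.zipWith (λ { (even , large , e≤N) →
          even , ≤-trans (≤-trans (m≤m+n _ 1) (≤-reflexive (lem₁ k))) large
          , ≤-trans e≤N (≤-trans (≤-trans (m≤m+n N N) (≤-reflexive (trans (cong (λ M → M + M) (sym (m+[n∸m]≡n K≤N))) (lem₂ K (N ∸ K))))) (m≤m+n _ _)) })
        (Allₚ.all-filter (T? ∘ isEven) p , All.zip (large , Allₚ.filter⁺ (T? ∘ isEven) bound))

      od-multiset : IsOddMultiset K od
      od-multiset = record
        { sorted = sorted-od
        ; odds   = All.zipWith (λ { (odd , x≤o) → odd , ≤-<-trans x≤o (≤-reflexive (sym (2*-suc k))) }) (odds-od , od≤o)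
        ; counts = λ i i<K → subst TwoOrThree (trans (cong (count (suc (2 * i))) p≡)
            (count-++-none ev od (All.map (λ {e} even e≡ → even-not-odd e even (subst (T ∘ isOdd) (sym e≡) (1+2*-odd i)))
              (Allₚ.all-filter (T? ∘ isEven) p)))) (counts-p i i<K) }

  block⇒sorted : ∀ N k {p} → p ∈ block N k → AllPairs _≥_ p × All (1 ≤_) p
  block⇒sorted N k p∈ with block⁻ N k p∈
  ... | ev , od , ev∈ , od∈ , refl with evenSets⁻ (k + k) ((N ∸ k) + (N ∸ k)) ev∈ | oddMultisets⁻ k od∈
  ...   | dec , evens | h =
    AllPairsₚ.++⁺ (AllPairs.map <⇒≤ dec) (sorted h)
      (All.map (λ { (_ , s<e , _) → All.map (λ { (_ , o<) →
        ≤-trans (<⇒≤ o<) (≤-trans (*-monoʳ-≤ 2 (m≤m+n k k)) (<⇒≤ s<e)) }) (odds h) }) evens)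
    , Allₚ.++⁺ (All.map (λ { (_ , s<e , _) → ≤-trans (s≤s z≤n) s<e }) evens) (All.map (λ { (odd , _) → odd-positive odd }) (odds h))

  block⇒cond : ∀ N k {p} → p ∈ block N k → T (condAᵇ p ∨ condBᵇ p)
  block⇒cond N zero p∈ with block⁻ N 0 p∈
  ... | ev , .[] , ev∈ , here refl , refl with evenSets⁻ 0 (N + N) ev∈
  ...   | dec , evens rewrite Listₚ.++-identityʳ ev = from T-∨ (inj₁ (from T-∧
    (Allₚ.all⁻ isEven (All.map proj₁ evens) , decreasing⇒distinct dec)))
  block⇒cond N (suc k) p∈ with block⁻ N (suc k) p∈
  ... | ev , od , ev∈ , od∈ , refl with evenSets⁻ (suc k + suc k) ((N ∸ suc k) + (N ∸ suc k)) ev∈ | oddMultisets⁻ (suc k) od∈ | oddMultisets-head k od∈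
  ...   | dec , evens | h | t , refl = from (T-∨ {condAᵇ (ev ++ od)}) (inj₂
    (subst₂ (λ od′ ev′ → T (condB-parts od′ ev′ (ev ++ od))) (sym (odds-++ even odd)) (sym (evens-++ even odd))
      (condB-parts⁺ {k} od ev (ev ++ od) (max-sorted (AllPairs.head (sorted h))) (s≤s z≤n)
        (λ i i<K → subst TwoOrThree (sym (count-++-none ev od (All.map (λ {e} even e≡ →
          even-not-odd e even (subst (T ∘ isOdd) (sym e≡) (1+2*-odd i))) even))) (counts h i i<K))
        dec (All.map large evens))))
    where
    even : All (T ∘ isEven) ev
    even = All.map proj₁ evens
    odd : All (T ∘ isOdd) od
    odd = All.map proj₁ (odds h)
    lem₁ : ∀ k → 2 * suc (2 * k) + 4 ≡ 2 * suc (suc k + suc k)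
    lem₁ = solve-∀
    -- Parity sharpens the strict bound: an even number above 4(k+1) is at least 4(k+1) + 2 =
    -- 2(2k+1) + 4.
    large : ∀ {e} → EvenIn (suc k + suc k) ((N ∸ suc k) + (N ∸ suc k)) e → 2 * suc (2 * k) + 4 ≤ e
    large {e} (even , s<e , _) with even⇒2* e even
    ... | m , refl = ≤-trans (≤-reflexive (lem₁ k)) (*-monoʳ-≤ 2 (*-cancelˡ-< 2 (suc k + suc k) m s<e))

  -- The list of all partitions of n, and the comparison with the candidates.

  parts≤sum : ∀ p → All (_≤ sum p) p
  parts≤sum []      = []
  parts≤sum (x ∷ p) = m≤m+n x (sum p) ∷ All.map (λ y≤ → ≤-trans y≤ (m≤n+m (sum p) x)) (parts≤sum p)

  length≤sum : ∀ {p} → All (1 ≤_) p → length p ≤ sum p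
  length≤sum []          = z≤n
  length≤sum (1≤x ∷ pos) = +-mono-≤ 1≤x (length≤sum pos)

  listsOf-cartesian : ∀ n k → listsOf n (suc k) ≡ cartesianProductWith _∷_ (applyUpTo suc n) (listsOf n k)
  listsOf-cartesian n k = lem (applyUpTo suc n)
    where
    lem : ∀ xs → concatMap (λ x → map (x ∷_) (listsOf n k)) xs ≡ cartesianProductWith _∷_ xs (listsOf n k)
    lem []       = refl
    lem (x ∷ xs) = cong (map (x ∷_) (listsOf n k) ++_) (lem xs)

  listsOf⁺ : ∀ {n p} → All (1 ≤_) p → All (_≤ n) p → p ∈ listsOf n (length p)
  listsOf⁺ []                  []           = here refl
  listsOf⁺ {n} {suc x ∷ p} (_ ∷ pos) (x<n ∷ bound) = subst (_ ∈_) (sym (listsOf-cartesian n (length p)))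
    (∈-cartesianProductWith⁺ _∷_ (∈-applyUpTo⁺ suc x<n) (listsOf⁺ pos bound))

  listsOf-length : ∀ n k {p} → p ∈ listsOf n k → length p ≡ k
  listsOf-length n zero    (here refl) = refl
  listsOf-length n (suc k) p∈
    with ∈-cartesianProductWith⁻ _∷_ (applyUpTo suc n) (listsOf n k) (subst (_ ∈_) (listsOf-cartesian n k) p∈)
  ... | _ , _ , _ , q∈ , refl = cong suc (listsOf-length n k q∈)

  listsOf-unique : ∀ n k → Unique (listsOf n k)
  listsOf-unique n zero    = [] ∷ []
  listsOf-unique n (suc k) = subst Unique (sym (listsOf-cartesian n k))
    (Uniqueₚ.cartesianProductWith⁺ _∷_ Listₚ.∷-injective
      (Uniqueₚ.applyUpTo⁺₁ suc n (λ i<j _ eq → <⇒≢ i<j (suc-injective eq))) (listsOf-unique n k))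

  partitions-unique : ∀ n → Unique (partitions n)
  partitions-unique n = Uniqueₚ.filter⁺ (T? ∘ isPartitionᵇ n) (Uniqueₚ.concat⁺
    (Allₚ.map⁺ (All.universal (listsOf-unique n) (upTo (suc n))))
    (AllPairsₚ.map⁺ (AllPairs.map disjoint (Uniqueₚ.upTo⁺ (suc n)))))
    where
    disjoint : ∀ {i j} → i ≢ j → Disjoint (listsOf n i) (listsOf n j)
    disjoint {i} {j} i≢j (p∈ , p∈′) = i≢j (trans (sym (listsOf-length n i p∈)) (listsOf-length n j p∈′))

  partitions⁺ : ∀ {n p} → AllPairs _≥_ p → All (1 ≤_) p → sum p ≡ n → p ∈ partitions n
  partitions⁺ {n} {p} sorted pos refl = ∈-filter⁺ (T? ∘ isPartitionᵇ n)
    (∈-concat⁺′ (listsOf⁺ pos (parts≤sum p)) (∈-map⁺ (listsOf n) (∈-upTo⁺ (s≤s (length≤sum pos)))))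
    (from T-∧ (sorted⇒nonInc sorted , from T-∧ (Allₚ.all⁻ _ (All.map ≤⇒≤ᵇ pos) , ≡⇒≡ᵇ (sum p) (sum p) refl)))

  partitions⁻ : ∀ n {p} → p ∈ partitions n → AllPairs _≥_ p × All (1 ≤_) p × sum p ≡ n
  partitions⁻ n {p} p∈ with to (T-∧ {nonIncᵇ p}) (proj₂ (∈-filter⁻ (T? ∘ isPartitionᵇ n) {xs = concatMap (listsOf n) (upTo (suc n))} p∈))
  ... | t₁ , t with to (T-∧ {all (1 ≤ᵇ_) p}) t
  ...   | t₂ , t₃ = nonInc⇒sorted p t₁ , All.map (λ {x} → ≤ᵇ⇒≤ 1 x) (Allₚ.all⁺ _ p t₂) , ≡ᵇ⇒≡ (sum p) n t₃

  -- Both lists are free of repetitions and have the same members, so they are permutations of each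
  -- other and have equal length.
  c5-candidates : ∀ n N → n ≤ N → c5 n ≡ length (filterᵇ (λ p → sum p ≡ᵇ n) (candidates N))
  c5-candidates n N n≤N = ↭-length (∼bag⇒↭ (unique∧set⇒bag
    (Uniqueₚ.filter⁺ (T? ∘ cond) (partitions-unique n))
    (Uniqueₚ.filter⁺ (T? ∘ sums) (candidates-unique N))
    (mk⇔ forward backward)))
    where
    cond sums : List ℕ → Bool
    cond p = condAᵇ p ∨ condBᵇ p
    sums p = sum p ≡ᵇ n

    forward : ∀ {p} → p ∈ filterᵇ cond (partitions n) → p ∈ filterᵇ sums (candidates N)
    forward {p} p∈ with ∈-filter⁻ (T? ∘ cond) {xs = partitions n} p∈
    ... | p∈′ , t with partitions⁻ n p∈′
    ...   | sorted , pos , refl = ∈-filter⁺ (T? ∘ sums) (member (to (T-∨ {condAᵇ p}) t)) (≡⇒≡ᵇ (sum p) (sum p) refl)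
      where
      bound : All (_≤ N) p
      bound = All.map (λ x≤ → ≤-trans x≤ n≤N) (parts≤sum p)
      member : T (condAᵇ p) Data.Sum.⊎ T (condBᵇ p) → p ∈ candidates N
      member (inj₁ a) = condA⇒candidate N sorted pos bound a
      member (inj₂ b) = condB⇒candidate N sorted bound b

    backward : ∀ {p} → p ∈ filterᵇ sums (candidates N) → p ∈ filterᵇ cond (partitions n)
    backward {p} p∈ with ∈-filter⁻ (T? ∘ sums) {xs = candidates N} p∈
    ... | p∈′ , t with candidates⁻ N p∈′
    ...   | k , p∈ₖ with block⇒sorted N k p∈ₖ
    ...     | sorted , pos = ∈-filter⁺ (T? ∘ cond) (partitions⁺ sorted pos (≡ᵇ⇒≡ (sum p) n t)) (block⇒cond N k p∈ₖ)

open Enumeration using (c5-candidates)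

-- From coefficients over 𝔽₂ to the parity of c₅.

module Exponents where

  open import Defs
  open import Data.Bool using (true; false; _xor_; not; if_then_else_)
  open import Data.Bool.Properties using (T-≡)
  open import Data.List using (List; []; _∷_; _++_; map; concat; applyUpTo; length; filterᵇ)
  open import Data.List.Membership.Propositional using (_∈_)
  open import Data.List.Membership.Propositional.Properties
  open import Data.List.Relation.Unary.All as All using (All; []; _∷_)
  import Data.List.Relation.Unary.All.Properties as Allₚ
  open import Data.List.Relation.Unary.AllPairs using ([]; _∷_)
  import Data.List.Relation.Unary.AllPairs.Properties as AllPairsₚ
  open import Data.List.Relation.Unary.Any using (here; there)
  open import Data.List.Relation.Unary.Unique.Propositional using (Unique)
  import Data.List.Relation.Unary.Unique.Propositional.Properties as Uniqueₚ
  open import Data.List.Relation.Binary.Disjoint.Propositional using (Disjoint)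
  open import Data.Nat using (ℕ; zero; suc; _≤_; _<_; z≤n; s≤s; _≡ᵇ_; _%_)
  import Data.Nat as ℕ
  open import Data.Nat.DivMod using (%-distribˡ-+)
  open import Data.Nat.ListAction using (sum)
  open import Data.Nat.Properties hiding (_≟_)
  open import Data.Nat.Tactic.RingSolver using (solve-∀)
  open import Data.Integer using (ℤ; +_; -[1+_]; _+_; _*_; -_; +[1+_])
  import Data.Integer.Properties as ℤₚ
  import Data.Integer.Tactic.RingSolver as ℤ-Solver
  open import Data.Product using (∃; _×_; _,_)
  open import Data.Sum using (_⊎_; inj₁; inj₂)
  open import Function using (_∘_; Equivalence)
  open import Relation.Binary.PropositionalEquality
  open import Relation.Nullary using (¬_; contradiction)

  open Equivalence using (to; from)

  ≢⇒≡ᵇ-false : ∀ {x n} → x ≢ n → (x ≡ᵇ n) ≡ false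
  ≢⇒≡ᵇ-false {x} {n} x≢n with x ≡ᵇ n in eq
  ... | true  = contradiction (≡ᵇ⇒≡ x n (from T-≡ eq)) x≢n
  ... | false = refl

  ⟪⟫-∉ : ∀ {n L} → All (_≢ n) L → ⟪ L , (_≡ᵇ n) ⟫ ≡ false
  ⟪⟫-∉ []          = refl
  ⟪⟫-∉ (x≢n ∷ L≢n) = cong₂ _xor_ (≢⇒≡ᵇ-false x≢n) (⟪⟫-∉ L≢n)

  ⟪⟫-∈ : ∀ {n L} → Unique L → n ∈ L → ⟪ L , (_≡ᵇ n) ⟫ ≡ true
  ⟪⟫-∈ {n} (n∉L ∷ _) (here refl) =
    cong₂ _xor_ (to T-≡ (≡⇒≡ᵇ n n refl)) (⟪⟫-∉ (All.map (λ n≢x x≡n → n≢x (sym x≡n)) n∉L))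
  ⟪⟫-∈ (x∉L ∷ L!) (there n∈L) = cong₂ _xor_ (≢⇒≡ᵇ-false (All.lookup x∉L n∈L)) (⟪⟫-∈ L! n∈L)

  parity-suc : ∀ m {b} → m % 2 ≡ (if b then 1 else 0) → suc m % 2 ≡ (if not b then 1 else 0)
  parity-suc m {b} eq = trans (%-distribˡ-+ 1 m 2) (trans (cong (λ r → (1 ℕ.+ r) % 2) eq) (lem b))
    where
    lem : ∀ b → (1 ℕ.+ (if b then 1 else 0)) % 2 ≡ (if not b then 1 else 0)
    lem true  = refl
    lem false = refl

  -- The passage from counting to 𝔽₂: the parity of the number of lists of sum n is the coefficient
  -- of q^n in the polynomial of their sums.
  length-filter-parity : ∀ n ls → length (filterᵇ (λ p → sum p ≡ᵇ n) ls) % 2 ≡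
    (if ⟪ map sum ls , (_≡ᵇ n) ⟫ then 1 else 0)
  length-filter-parity n []       = refl
  length-filter-parity n (p ∷ ls) with sum p ≡ᵇ n
  ... | true  = parity-suc (length (filterᵇ (λ p → sum p ≡ᵇ n) ls)) (length-filter-parity n ls)
  ... | false = length-filter-parity n ls

  exponentPair : ℕ → List ℕ
  exponentPair r = exponent⁺ r ∷ exponent⁻ r ∷ []

  exponents : ℕ → List ℕ
  exponents N = 0 ∷ concat (applyUpTo exponentPair N)

  c5-parity : ∀ n → c5 n % 2 ≡ (if ⟪ exponents (suc n) , (_≡ᵇ n) ⟫ then 1 else 0)
  c5-parity n = trans (cong (_% 2) (c5-candidates n (suc n) (n≤1+n n)))
    (trans (length-filter-parity n (candidates (suc n)))
      (cong (λ b → if b then 1 else 0) (trans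
        -- The cut-off K = n + 1 is the least for which reading off the coefficient of q^n kills all
        -- q^i with i ≥ K.
        (Truncated._≋_.⟪⟫-eq (map-sum-candidates (suc n) (suc n) ≤-refl) (_≡ᵇ n) (λ i n<i → ≢⇒≡ᵇ-false (λ i≡n → <⇒≢ n<i (sym i≡n))))
        (cong (λ L → ⟪ 0 ∷ L , (_≡ᵇ n) ⟫) (∑-concat (suc n) exponentPair)))))
    where
    open Truncated (suc n) using (∑)
    ∑-concat : ∀ N f → ∑ N f ≡ concat (applyUpTo f N)
    ∑-concat zero    f = refl
    ∑-concat (suc N) f = cong (f 0 ++_) (∑-concat N (f ∘ suc))

  -- The exponents (7j² + j)/2 are pairwise distinct.

  τ-mono : ∀ {i j} → i ≤ j → τ i ≤ τ j
  τ-mono {i} {j} i≤j = subst (λ k → τ i ≤ τ k) (m∸n+n≡m i≤j) (grow (j ℕ.∸ i))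
    where
    grow : ∀ d → τ i ≤ τ (d ℕ.+ i)
    grow zero    = ≤-refl
    grow (suc d) = ≤-trans (grow d) (m≤m+n _ _)

  exponent⁻<exponent⁺ : ∀ r → exponent⁻ r < exponent⁺ r
  exponent⁻<exponent⁺ r = +-monoˡ-< (2 ℕ.* (suc r ℕ.* suc r)) (+-monoʳ-< (τ r) (m<m+n (suc r) (s≤s z≤n)))

  exponent⁺<exponent⁻ : ∀ {i j} → i < j → exponent⁺ i < exponent⁻ j
  exponent⁺<exponent⁻ {i} {suc j} (s≤s i≤j) = ≤-<-trans
    (+-mono-≤ (+-mono-≤ (τ-mono i≤j) (*-monoʳ-≤ 2 (s≤s i≤j))) (*-monoʳ-≤ 2 (*-mono-≤ (s≤s i≤j) (s≤s i≤j))))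
    (≤-trans (m<m+n _ (s≤s z≤n)) (≤-reflexive (lem (τ j) j)))
    where
    -- The last summand on the left is the gap 6j + 9 between `exponent⁺ j` and `exponent⁻ (suc j)`,
    -- written as a successor.
    lem : ∀ t j → t ℕ.+ 2 ℕ.* suc j ℕ.+ 2 ℕ.* (suc j ℕ.* suc j) ℕ.+ suc (suc (j ℕ.+ suc j) ℕ.+ 2 ℕ.* (1 ℕ.+ (suc j ℕ.+ suc j)))
      ≡ t ℕ.+ 3 ℕ.* suc j ℕ.+ suc (suc j) ℕ.+ 2 ℕ.* (suc (suc j) ℕ.* suc (suc j))
    lem = solve-∀

  exponent⁻-positive : ∀ r → 0 < exponent⁻ r
  exponent⁻-positive r = ≤-trans (s≤s z≤n) (≤-trans (m≤n+m (suc r) (τ r)) (m≤m+n (τ r ℕ.+ suc r) _))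

  -- The exponents interlace: 0 < `exponent⁻ 0` < `exponent⁺ 0` < `exponent⁻ 1` < ..., so each pair
  -- occupies an interval of its own.
  exponents-unique : ∀ N → Unique (exponents N)
  exponents-unique N = Allₚ.concat⁺ (Allₚ.applyUpTo⁺₂ exponentPair N (λ r →
      <⇒≢ (<-trans (exponent⁻-positive r) (exponent⁻<exponent⁺ r)) ∷ <⇒≢ (exponent⁻-positive r) ∷ []))
    ∷ Uniqueₚ.concat⁺
      (Allₚ.applyUpTo⁺₂ exponentPair N (λ r → ((λ eq → <⇒≢ (exponent⁻<exponent⁺ r) (sym eq)) ∷ []) ∷ [] ∷ []))
      (AllPairsₚ.applyUpTo⁺₁ exponentPair N (λ i<j _ → disjoint i<j))
    where
    ≤exponent⁺ : ∀ {i x} → x ∈ exponentPair i → x ≤ exponent⁺ i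
    ≤exponent⁺     (here refl)         = ≤-refl
    ≤exponent⁺ {i} (there (here refl)) = <⇒≤ (exponent⁻<exponent⁺ i)

    ≥exponent⁻ : ∀ {j x} → x ∈ exponentPair j → exponent⁻ j ≤ x
    ≥exponent⁻ {j} (here refl)         = <⇒≤ (exponent⁻<exponent⁺ j)
    ≥exponent⁻     (there (here refl)) = ≤-refl

    disjoint : ∀ {i j} → i < j → Disjoint (exponentPair i) (exponentPair j)
    disjoint i<j (x∈ , x∈′) = <⇒≱ (exponent⁺<exponent⁻ i<j) (≤-trans (≥exponent⁻ x∈′) (≤exponent⁺ x∈))

  -- The exponents as values of (7j² + j)/2 at integers j.

  2*τ : ∀ r → 2 ℕ.* τ r ≡ 3 ℕ.* (r ℕ.* suc r)
  2*τ zero    = refl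
  2*τ (suc r) = trans (*-distribˡ-+ 2 (τ r) (3 ℕ.* suc r)) (trans (cong (ℕ._+ 2 ℕ.* (3 ℕ.* suc r)) (2*τ r)) (lem r))
    where
    lem : ∀ r → 3 ℕ.* (r ℕ.* suc r) ℕ.+ 2 ℕ.* (3 ℕ.* suc r) ≡ 3 ℕ.* (suc r ℕ.* suc (suc r))
    lem = solve-∀

  2*exponent⁺ : ∀ r → 2 ℕ.* exponent⁺ r ≡ 7 ℕ.* suc r ℕ.* suc r ℕ.+ suc r
  2*exponent⁺ r = trans (lem₁ (τ r) r) (trans (cong (ℕ._+ 4 ℕ.* (suc r ℕ.+ suc r ℕ.* suc r)) (2*τ r)) (lem₂ r))
    where
    lem₁ : ∀ t r → 2 ℕ.* (t ℕ.+ 2 ℕ.* suc r ℕ.+ 2 ℕ.* (suc r ℕ.* suc r)) ≡ 2 ℕ.* t ℕ.+ 4 ℕ.* (suc r ℕ.+ suc r ℕ.* suc r)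
    lem₁ = solve-∀
    lem₂ : ∀ r → 3 ℕ.* (r ℕ.* suc r) ℕ.+ 4 ℕ.* (suc r ℕ.+ suc r ℕ.* suc r) ≡ 7 ℕ.* suc r ℕ.* suc r ℕ.+ suc r
    lem₂ = solve-∀

  -- For j = -(r+1) the linear term is negative; it is moved to the left so that no truncated
  -- subtraction arises.
  2*exponent⁻ : ∀ r → 2 ℕ.* exponent⁻ r ℕ.+ suc r ≡ 7 ℕ.* suc r ℕ.* suc r
  2*exponent⁻ r = trans (lem₁ (τ r) r) (trans (cong (ℕ._+ (3 ℕ.* suc r ℕ.+ 4 ℕ.* (suc r ℕ.* suc r))) (2*τ r)) (lem₂ r))
    where
    lem₁ : ∀ t r → 2 ℕ.* (t ℕ.+ suc r ℕ.+ 2 ℕ.* (suc r ℕ.* suc r)) ℕ.+ suc r ≡ 2 ℕ.* t ℕ.+ (3 ℕ.* suc r ℕ.+ 4 ℕ.* (suc r ℕ.* suc r))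
    lem₁ = solve-∀
    lem₂ : ∀ r → 3 ℕ.* (r ℕ.* suc r) ℕ.+ (3 ℕ.* suc r ℕ.+ 4 ℕ.* (suc r ℕ.* suc r)) ≡ 7 ℕ.* suc r ℕ.* suc r
    lem₂ = solve-∀

  IsExponent : ℕ → Set
  IsExponent n = ∃ λ (j : ℤ) → + (2 ℕ.* n) ≡ (+ 7) * j * j + j

  pos-7jj : ∀ m → (+ 7) * + m * + m ≡ + (7 ℕ.* m ℕ.* m)
  pos-7jj m = trans (cong (_* + m) (sym (ℤₚ.pos-* 7 m))) (sym (ℤₚ.pos-* (7 ℕ.* m) m))

  neg-7jj : ∀ m → (+ 7) * (- + m) * (- + m) ≡ + (7 ℕ.* m ℕ.* m)
  neg-7jj m = trans (lem (+ m)) (pos-7jj m)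
    where
    lem : ∀ i → (+ 7) * (- i) * (- i) ≡ (+ 7) * i * i
    lem = ℤ-Solver.solve-∀

  exponent⁺-isExponent : ∀ r → IsExponent (exponent⁺ r)
  exponent⁺-isExponent r = + suc r , trans (cong +_ (2*exponent⁺ r))
    (trans (ℤₚ.pos-+ (7 ℕ.* suc r ℕ.* suc r) (suc r)) (cong (_+ + suc r) (sym (pos-7jj (suc r)))))

  exponent⁻-isExponent : ∀ r → IsExponent (exponent⁻ r)
  exponent⁻-isExponent r = - + suc r , trans (lem _ (+ suc r))
    (cong (_+ - + suc r) (trans (sym (ℤₚ.pos-+ (2 ℕ.* exponent⁻ r) (suc r))) (trans (cong +_ (2*exponent⁻ r)) (sym (neg-7jj (suc r))))))
    where
    lem : ∀ i j → i ≡ i + j + (- j)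
    lem = ℤ-Solver.solve-∀

  isExponent⇒exponent : ∀ n → IsExponent n → n ≡ 0 ⊎ ∃ λ r → n ≡ exponent⁺ r ⊎ n ≡ exponent⁻ r
  isExponent⇒exponent n (+ 0 , eq)     = inj₁ (*-cancelˡ-≡ n 0 2 (ℤₚ.+-injective eq))
  isExponent⇒exponent n (+[1+ r ] , eq) = inj₂ (r , inj₁ (*-cancelˡ-≡ n _ 2 (trans
    (ℤₚ.+-injective (trans eq (trans (cong (_+ + suc r) (pos-7jj (suc r))) (sym (ℤₚ.pos-+ (7 ℕ.* suc r ℕ.* suc r) (suc r))))))
    (sym (2*exponent⁺ r)))))
  isExponent⇒exponent n (-[1+ r ] , eq) = inj₂ (r , inj₂ (*-cancelˡ-≡ n _ 2 (+-cancelʳ-≡ (suc r) _ _ (trans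
    (ℤₚ.+-injective (trans (ℤₚ.pos-+ (2 ℕ.* n) (suc r)) (trans (cong (_+ + suc r) eq)
      (trans (lem ((+ 7) * (- + suc r) * (- + suc r)) (+ suc r)) (neg-7jj (suc r))))))
    (sym (2*exponent⁻ r))))))
    where
    lem : ∀ i j → i + (- j) + j ≡ i
    lem = ℤ-Solver.solve-∀

  ∈-exponents⁺ : ∀ {n} → IsExponent n → n ∈ exponents (suc n)
  ∈-exponents⁺ {n} s with isExponent⇒exponent n s
  ... | inj₁ refl              = here refl
  -- An exponent is at least its index r, so r ≤ n and the pair lies in the range r < n + 1; the
  -- same holds in the next case.
  ... | inj₂ (r , inj₁ refl) = there (∈-concat⁺′ (here refl) (∈-applyUpTo⁺ exponentPair
    (s≤s (≤-trans (n≤1+n r) (≤-trans (m≤m+n (suc r) _) (≤-trans (m≤n+m (2 ℕ.* suc r) (τ r)) (m≤m+n _ _)))))))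
  ... | inj₂ (r , inj₂ refl) = there (∈-concat⁺′ (there (here refl)) (∈-applyUpTo⁺ exponentPair
    (s≤s (≤-trans (n≤1+n r) (≤-trans (m≤n+m (suc r) (τ r)) (m≤m+n _ _))))))

  ∈-exponents⁻ : ∀ N {x} → x ∈ exponents N → IsExponent x
  ∈-exponents⁻ N (here refl) = + 0 , refl
  ∈-exponents⁻ N (there x∈) with ∈-concat⁻′ (applyUpTo exponentPair N) x∈
  ... | _ , x∈exponentPair , exponentPair∈ with ∈-applyUpTo⁻ exponentPair exponentPair∈
  ...   | r , _ , refl with x∈exponentPair
  ...     | here refl         = exponent⁺-isExponent r
  ...     | there (here refl) = exponent⁻-isExponent r

open import Defs
open import Data.Nat using (ℕ; _%_)
open import Data.Integer using (ℤ; +_; _+_; _*_)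
open import Data.Product using (∃; _×_)
open import Relation.Nullary using (¬_)
open import Relation.Binary.PropositionalEquality using (_≡_)
open import Data.Bool using (if_then_else_)
open import Data.Nat using (suc)
open import Data.List.Relation.Unary.All using (tabulate)
open import Data.Product using (_,_)
open import Relation.Binary.PropositionalEquality using (refl; cong; trans)
open Exponents

theorem6 : (n : ℕ) →
    ((∃ λ (j : ℤ) → + (2 Data.Nat.* n) ≡ (+ 7) * j * j + j) → c5 n % 2 ≡ 1)
    × ((¬ ∃ λ (j : ℤ) → + (2 Data.Nat.* n) ≡ (+ 7) * j * j + j) → c5 n % 2 ≡ 0)
theorem6 n =
    (λ s → trans (c5-parity n) (cong (λ b → if b then 1 else 0)
      (⟪⟫-∈ {n} (exponents-unique (suc n)) (∈-exponents⁺ s))))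
  , (λ ¬s → trans (c5-parity n) (cong (λ b → if b then 1 else 0)
      (⟪⟫-∉ {n} (tabulate (λ { x∈ refl → ¬s (∈-exponents⁻ (suc n) x∈) })))))
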